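{- For every $\delta>0$ there is $n_0$ such that for every $n\ge n_0$ and every $n$-vertex 2-factor $F$, every red/blue-coloring of $E(K_n)$ contains a copy of $F$ with at least $(2/3-\delta)n$ edges of the same color.
   Context: A 2-factor on $n$ vertices is a 2-regular graph on $n$ vertices (a vertex-disjoint union of cycles covering all vertices). A copy of $F$ in $K_n$ is a subgraph of $K_n$ isomorphic to $F$. -}

module Defs where

open import Data.Bool using (Bool; false; not; T; T?)
open import Data.Fin using (Fin; _<?_; _≟_)
open import Data.Fin.Subset using (Subset; _∈_; ∣_∣)
open import Data.Integer using (+_)
open import Data.List using (List; allFin; cartesianProduct; filter; length)
open import Data.Nat using (ℕ)
open import Data.Product using (Σ; _×_; _,_; proj₁)
open import Data.Rational using (ℚ; _/_)
open import Data.Vec using (tabulate)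
open import Function.Bundles using (_↔_; Inverse)
open import Relation.Binary.Definitions using (DecidableEquality)
open import Relation.Binary.PropositionalEquality using (_≡_; refl; sym)
open import Relation.Nullary using (yes; no)
open import Relation.Nullary.Decidable using (⌊_⌋; _×-dec_)
open import Data.Empty using (⊥-elim)

record Graph (V : Set) : Set where
  field
    adj        : V → V → Bool
    adj-sym    : ∀ u v → adj u v ≡ adj v u
    adj-irrefl : ∀ v → adj v v ≡ false

open Graph public

record _≅_ {V W : Set} (G : Graph V) (H : Graph W) : Set where
  field
    bijection : V ↔ W
    preserves : ∀ u v → adj G u v ≡ adj H (Inverse.to bijection u) (Inverse.to bijection v)

degree : ∀ {n} → Graph (Fin n) → Fin n → ℕ
degree G u = ∣ tabulate (adj G u) ∣

TwoFactor : ∀ {n} → Graph (Fin n) → Set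
TwoFactor G = ∀ v → degree G v ≡ 2

distinct : ∀ {n} → Fin n → Fin n → Bool
distinct u v = not ⌊ u ≟ v ⌋

distinct-sym : ∀ {n} (u v : Fin n) → distinct u v ≡ distinct v u
distinct-sym u v with u ≟ v | v ≟ u
... | yes _   | yes _   = refl
... | no _    | no _    = refl
... | yes u≡v | no v≢u  = ⊥-elim (v≢u (sym u≡v))
... | no u≢v  | yes v≡u = ⊥-elim (u≢v (sym v≡u))

distinct-irrefl : ∀ {n} (v : Fin n) → distinct v v ≡ false
distinct-irrefl v with v ≟ v
... | yes _  = refl
... | no v≢v = ⊥-elim (v≢v refl)

K : ∀ n → Graph (Fin n)
K n = record
  { adj        = distinct
  ; adj-sym    = distinct-sym
  ; adj-irrefl = distinct-irrefl
  }

record Subgraph {n} (G : Graph (Fin n)) : Set where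
  field
    vertices    : Subset n
    edge        : Fin n → Fin n → Bool
    edge-sym    : ∀ u v → edge u v ≡ edge v u
    edge-irrefl : ∀ v → edge v v ≡ false
    edge⇒adj    : ∀ u v → T (edge u v) → T (adj G u v)
    edge⇒∈      : ∀ u v → T (edge u v) → u ∈ vertices

open Subgraph public

toGraph : ∀ {n} {G : Graph (Fin n)} (H : Subgraph G) → Graph (Σ (Fin n) (_∈ vertices H))
toGraph H = record
  { adj        = λ u v → edge H (proj₁ u) (proj₁ v)
  ; adj-sym    = λ u v → edge-sym H (proj₁ u) (proj₁ v)
  ; adj-irrefl = λ v → edge-irrefl H (proj₁ v)
  }

record Copy {m n} (F : Graph (Fin m)) (G : Graph (Fin n)) : Set where
  field
    subgraph : Subgraph G
    iso      : F ≅ toGraph subgraph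

open Copy public

data Colour : Set where
  red blue : Colour

_≟ᶜ_ : DecidableEquality Colour
red  ≟ᶜ red  = yes refl
red  ≟ᶜ blue = no λ ()
blue ≟ᶜ red  = no λ ()
blue ≟ᶜ blue = yes refl

-- Colours are assigned to all pairs of vertices; the values on pairs that are
-- not edges of G (for K n, the diagonal) are irrelevant, since only edges of
-- subgraphs of G are ever counted.
record EdgeColouring {n} (G : Graph (Fin n)) : Set where
  field
    colour     : Fin n → Fin n → Colour
    colour-sym : ∀ u v → colour u v ≡ colour v u

open EdgeColouring public

-- Each undirected edge is listed once, as the pair (u , v) with u < v.
edgesOfColour : ∀ {n} {G : Graph (Fin n)} →
                EdgeColouring G → Colour → Subgraph G → List (Fin n × Fin n)
edgesOfColour {n} χ c H =
  filter (λ (u , v) → u <? v ×-dec T? (edge H u v) ×-dec colour χ u v ≟ᶜ c)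
         (cartesianProduct (allFin n) (allFin n))

#edgesOfColour : ∀ {n} {G : Graph (Fin n)} →
                 EdgeColouring G → Colour → Subgraph G → ℕ
#edgesOfColour χ c H = length (edgesOfColour χ c H)

fromℕ : ℕ → ℚ
fromℕ k = + k / 1

{-# OPTIONS --safe #-}
-- Since K n is complete, every bijection of the vertex sets gives a copy of F. By Ramsey's
-- theorem all but boundedly many vertices split into large monochromatic cliques; let A and B
-- be the unions of the red and of the blue ones. Cut F into cycles and paths of bounded length
-- (losing few edges). Greedily place a piece with l = k + k′ vertices, k = ⌊l/2⌋, alternately
-- on a red and on a blue clique such that the bipartite graph between the two parts is
-- monochromatic, the larger part on the side with more vertices left. In the colour c of that
-- graph the piece then has k edges more than it has vertices on the side of colour c.
-- For either colour c, keep the blocks of colour c and fill the rest of its side with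
-- monochromatic pieces. Up to small errors the numbers of red and blue edges obtained add up
-- to |A| + |B| + Σ k, where Σ k ≥ min (|A|, |B|, n/3). If |A|, |B| ≥ n/3 this is at least
-- 4n/3; otherwise one side alone has at least 2n/3 vertices.
module Submission where

-- Ramsey's theorem decides the hue of a block, so neither colour can be prescribed. Both
-- completions therefore start from one family of blocks, and each block brings its surplus k to
-- exactly one of them; averaging the two edge counts then suffices. The surplus is k for odd pieces
-- too: the closing edge of an odd cycle lies in the clique of the larger half. If the hue is the
-- colour of that clique, this edge counts as well; otherwise the side of the hue holds only k
-- vertices and the 2k path edges are enough. The lower bound on Σ k depends on why the construction
-- stops. If the pieces run out, l ≤ 3k (tight for triangles) gives n/3. If a side runs out, either
-- the other side has at most one vertex more left, so that the blocks cover almost everything and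
-- n/3 results again, or the exhausted side has received the smaller half of every block, so that Σ
-- k is almost its size. Giving the larger half to the side with more vertices left keeps this
-- alternative true throughout.

-- Counting in lists without repetition.

module ListLemmas where

  open import Data.List using (List; []; _∷_; _++_; length; map; filter)
  open import Data.List.Membership.Propositional using (_∈_; _∉_)
  open import Data.List.Membership.Propositional.Properties using (∈-∃++; ∈-++⁺ˡ; ∈-++⁺ʳ)
  open import Data.List.Properties using (∷-injectiveˡ; ∷-injectiveʳ)
  open import Data.List.Relation.Binary.Permutation.Propositional.Properties using (shift; ∈-resp-↭; ↭-length)
  open import Data.List.Relation.Binary.Sublist.Propositional using (_⊆_; []; _∷_; _∷ʳ_)
  open import Data.List.Relation.Binary.Sublist.Propositional.Properties using (All-resp-⊆)
  open import Data.List.Relation.Unary.All as All using (All; []; _∷_)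
  open import Data.List.Relation.Unary.AllPairs using (AllPairs; []; _∷_)
  open import Data.List.Relation.Unary.Any using (here; there)
  open import Data.List.Relation.Unary.Unique.Propositional using (Unique)
  open import Data.List.Relation.Unary.Unique.Propositional.Properties using (++⁺)
  open import Data.Nat using (suc; _+_; _≤_; z≤n; s≤s)
  open import Data.Nat.Properties
  open import Data.Product using (_×_; _,_)
  open import Data.Sum using (_⊎_; inj₁; inj₂)
  open import Relation.Binary.PropositionalEquality
  open import Relation.Nullary using (yes; no)
  open import Relation.Nullary.Negation using (contradiction)
  open import Relation.Unary using (Decidable)

  module _ {A : Set} where

    AllPairs-resp-⊇ : ∀ {R : A → A → Set} {xs ys : List A} → xs ⊆ ys → AllPairs R ys → AllPairs R xs
    AllPairs-resp-⊇ []         []         = []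
    AllPairs-resp-⊇ (y ∷ʳ τ)   (_ ∷ ps)   = AllPairs-resp-⊇ τ ps
    AllPairs-resp-⊇ (refl ∷ τ) (p ∷ ps)   = All-resp-⊆ τ p ∷ AllPairs-resp-⊇ τ ps

    unique-⊆-length : ∀ {xs ys : List A} → Unique xs → (∀ {x} → x ∈ xs → x ∈ ys) → length xs ≤ length ys
    unique-⊆-length {[]}     []       sub = z≤n
    unique-⊆-length {x ∷ xs} (p ∷ ps) sub with as , bs , refl ← ∈-∃++ (sub (here refl)) =
      subst (suc (length xs) ≤_) (sym (↭-length (shift x as bs)))
        (s≤s (unique-⊆-length ps λ {y} y∈ → other y∈ (∈-resp-↭ (shift x as bs) (sub (there y∈)))))
      where
      other : ∀ {y} → y ∈ xs → y ∈ x ∷ as ++ bs → y ∈ as ++ bs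
      other y∈ (here refl) = contradiction refl (All.lookup p y∈)
      other y∈ (there h)   = h

    Unique-++⁺ : ∀ {xs ys : List A} → Unique xs → Unique ys → (∀ {v} → v ∈ xs → v ∉ ys) → Unique (xs ++ ys)
    Unique-++⁺ uxs uys dis = ++⁺ uxs uys λ (h , k) → dis h k

    Unique-++⁻ : ∀ (xs : List A) {ys} → Unique (xs ++ ys) → Unique xs × Unique ys × (∀ {v} → v ∈ xs → v ∉ ys)
    Unique-++⁻ []       u = [] , u , λ ()
    Unique-++⁻ (x ∷ xs) (p ∷ u) with ux , uy , d ← Unique-++⁻ xs u =
      All.tabulate (λ h → All.lookup p (∈-++⁺ˡ h)) ∷ ux , uy ,
      λ where (here refl) h → All.lookup p (∈-++⁺ʳ xs h) refl
              (there h)   → d h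

    filter-split : ∀ {P Q : A → Set} (P? : Decidable P) (Q? : Decidable Q) (xs : List A) →
                   (∀ x → P x ⊎ Q x) → length xs ≤ length (filter P? xs) + length (filter Q? xs)
    filter-split P? Q? []       or = z≤n
    filter-split P? Q? (x ∷ xs) or with ih ← filter-split P? Q? xs or | P? x | Q? x
    ... | yes _  | yes _  = s≤s (≤-trans ih (+-monoʳ-≤ _ (n≤1+n _)))
    ... | yes _  | no _   = s≤s ih
    ... | no _   | yes _  = ≤-trans (s≤s ih) (≤-reflexive (sym (+-suc _ _)))
    ... | no ¬p  | no ¬q  = contradiction (or x) λ { (inj₁ p) → ¬p p ; (inj₂ q) → ¬q q }

    map-id-∈ : ∀ {f : A → A} {xs} → map f xs ≡ xs → ∀ {x} → x ∈ xs → f x ≡ x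
    map-id-∈ {xs = _ ∷ _} eq (here refl) = ∷-injectiveˡ eq
    map-id-∈ {xs = _ ∷ _} eq (there h)   = map-id-∈ (∷-injectiveʳ eq) h

  -- Pigeonhole with one unit to spare: if both alternatives failed, `x + y` would be at least
  -- `r + s + 2`. In Ramsey's theorem the spare unit pays for the vertex whose neighbourhoods are
  -- taken.
  +-≤-split : ∀ {x y r s} → x + y ≤ suc (r + s) → x ≤ r ⊎ y ≤ s
  +-≤-split {x} {y} {r} {s} h with x ≤? r | y ≤? s
  ... | yes p | _     = inj₁ p
  ... | no _  | yes q = inj₂ q
  ... | no p  | no q  =
    contradiction (≤-trans (+-mono-≤ (≰⇒> p) (≰⇒> q)) h)
      (<⇒≱ (s≤s (≤-reflexive (sym (+-suc r s)))))

-- Ramsey's theorem for cliques and for bicliques.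

module Ramsey where

  open import Data.List using (List; []; _∷_; length; filter)
  open import Data.List.Relation.Binary.Sublist.Propositional
    using (_⊆_; []; _∷_; _∷ʳ_; ⊆-refl; ⊆-trans; minimum)
  open import Data.List.Relation.Binary.Sublist.Propositional.Properties using (filter-⊆; All-resp-⊆)
  open import Data.List.Relation.Unary.All as All using (All; []; _∷_)
  open import Data.List.Relation.Unary.All.Properties using (all-filter)
  open import Data.List.Relation.Unary.AllPairs using (AllPairs; []; _∷_)
  open import Data.Nat using (ℕ; zero; suc; _+_; _*_; _^_; _≤_; s≤s)
  open import Data.Nat.Properties
  open import Data.Product using (∃-syntax; _×_; _,_)
  open import Data.Sum using (_⊎_; inj₁; inj₂)
  open import Relation.Binary.PropositionalEquality
  open import Defs using (Colour; red; blue; _≟ᶜ_)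
  open ListLemmas

  ^-double : ∀ m → 2 ^ suc m ≡ 2 ^ m + 2 ^ m
  ^-double m = cong (2 ^ m +_) (+-identityʳ (2 ^ m))

  red-or-blue : ∀ c → c ≡ red ⊎ c ≡ blue
  red-or-blue red  = inj₁ refl
  red-or-blue blue = inj₂ refl

  module _ {V : Set} (col : V → V → Colour) where

    Mono : Colour → List V → Set
    Mono c = AllPairs (λ u v → col u v ≡ c)

    Cross : Colour → List V → List V → Set
    Cross c X Y = All (λ x → All (λ y → col x y ≡ c) Y) X

    nbhd : Colour → V → List V → List V
    nbhd c x = filter (λ v → col x v ≟ᶜ c)

    nbhd-split : ∀ x xs → length xs ≤ length (nbhd red x xs) + length (nbhd blue x xs)
    nbhd-split x xs = filter-split _ _ xs (λ v → red-or-blue (col x v))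

    nbhd-colour : ∀ c x xs → All (λ v → col x v ≡ c) (nbhd c x xs)
    nbhd-colour c x xs = all-filter (λ v → col x v ≟ᶜ c) xs

    Clique : Colour → ℕ → List V → Set
    Clique c a xs = ∃[ ys ] ys ⊆ xs × length ys ≡ a × Mono c ys

    clique-cons : ∀ c {a} x xs → Clique c a (nbhd c x xs) → Clique c (suc a) (x ∷ xs)
    clique-cons c x xs (ys , τ , len , mono) =
      x ∷ ys , refl ∷ ⊆-trans τ (filter-⊆ _ xs) , cong suc len , All-resp-⊆ τ (nbhd-colour c x xs) ∷ mono

    clique-weaken : ∀ c d {a} x xs → Clique c a (nbhd d x xs) → Clique c a (x ∷ xs)
    clique-weaken c d x xs (ys , τ , r) = ys , x ∷ʳ ⊆-trans τ (filter-⊆ _ xs) , r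

    -- The head splits the remaining vertices into its red and its blue neighbours, and one of the
    -- two classes still has half of `2 ^ (a + b)` members. A red class lowers a, a blue one lowers
    -- b, and the head is added to a clique of the same colour.
    ramsey : ∀ a b xs → 2 ^ (a + b) ≤ length xs → Clique red a xs ⊎ Clique blue b xs
    ramsey zero    b       xs h = inj₁ ([] , minimum _ , refl , [])
    ramsey (suc a) zero    xs h = inj₂ ([] , minimum _ , refl , [])
    ramsey (suc a) (suc b) [] h = inj₁ (contra (m^n>0 2 (suc a + suc b)))
      where
      contra : ∀ {X : Set} → 1 ≤ 2 ^ (suc a + suc b) → X
      contra p with () ← ≤-trans p h
    ramsey (suc a) (suc b) (x ∷ xs) h
      with +-≤-split {2 ^ (a + suc b)} {2 ^ (a + suc b)} {length (nbhd red x xs)} {length (nbhd blue x xs)}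
             (≤-trans (≤-reflexive (sym (^-double (a + suc b)))) (≤-trans h (s≤s (nbhd-split x xs))))
    ... | inj₁ p with ramsey a (suc b) (nbhd red x xs) p
    ...   | inj₁ k = inj₁ (clique-cons red x xs k)
    ...   | inj₂ k = inj₂ (clique-weaken blue red x xs k)
    ramsey (suc a) (suc b) (x ∷ xs) h | inj₂ p
      with ramsey (suc a) b (nbhd blue x xs) (subst (λ k → 2 ^ k ≤ length (nbhd blue x xs)) (+-suc a b) p)
    ...   | inj₁ k = inj₁ (clique-weaken red blue x xs k)
    ...   | inj₂ k = inj₂ (clique-cons blue x xs k)

    Biclique : Colour → ℕ → ℕ → List V → List V → Set
    Biclique c i m P Q = ∃[ X ] ∃[ Y ] X ⊆ P × Y ⊆ Q × length X ≡ i × m ≤ length Y × Cross c X Y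

    biclique-cons : ∀ c {i m} x P Q → Biclique c i m P (nbhd c x Q) → Biclique c (suc i) m (x ∷ P) Q
    biclique-cons c x P Q (X , Y , τ , σ , len , m≤ , cr) =
      x ∷ X , Y , refl ∷ τ , ⊆-trans σ (filter-⊆ _ Q) , cong suc len , m≤ , All-resp-⊆ σ
          (nbhd-colour c x Q) ∷ cr

    biclique-weaken : ∀ c d {i m} x P Q → Biclique c i m P (nbhd d x Q) → Biclique c i m (x ∷ P) Q
    biclique-weaken c d x P Q (X , Y , τ , σ , r) =
      X , Y , x ∷ʳ τ , ⊆-trans σ (filter-⊆ _ Q) , r

    -- Each vertex of P restricts Q to one of its colour classes that keeps half of the required
    -- size, and is a candidate for X in that colour. After at most `i + j` vertices one colour has
    -- been chosen often enough, and at least m vertices of Q are left; the candidates of the other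
    -- colour are discarded.
    bipartite-ramsey : ∀ i j m P Q → i + j ≤ length P → 2 ^ (i + j) * m ≤ length Q →
                       Biclique red i m P Q ⊎ Biclique blue j m P Q
    bipartite-ramsey zero    j       m P Q hP hQ =
      inj₁ ([] , Q , minimum _ , ⊆-refl , refl , ≤-trans (m≤n*m m (2 ^ j) {{m^n≢0 2 j}}) hQ , [])
    bipartite-ramsey (suc i) zero    m P Q hP hQ =
      inj₂ ([] , Q , minimum _ , ⊆-refl , refl , ≤-trans (m≤n*m m (2 ^ (suc i + 0)) {{m^n≢0 2
          (suc i + 0)}}) hQ , [])
    bipartite-ramsey (suc i) (suc j) m (x ∷ P) Q (s≤s hP) hQ
      with +-≤-split {2 ^ (i + suc j) * m} {2 ^ (i + suc j) * m} {length (nbhd red x Q)} {length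
          (nbhd blue x Q)}
             (m≤n⇒m≤1+n (≤-trans (≤-reflexive (trans (sym (*-distribʳ-+ m (2 ^ (i + suc j)) _))
                 (cong (_* m) (sym (^-double (i + suc j))))))
                (≤-trans hQ (nbhd-split x Q))))
    ... | inj₁ p with bipartite-ramsey i (suc j) m P (nbhd red x Q) hP p
    ...   | inj₁ k = inj₁ (biclique-cons red x P Q k)
    ...   | inj₂ k = inj₂ (biclique-weaken blue red x P Q k)
    bipartite-ramsey (suc i) (suc j) m (x ∷ P) Q (s≤s hP) hQ | inj₂ p
      with bipartite-ramsey (suc i) j m P (nbhd blue x Q) (subst (_≤ length P) (+-suc i j) hP)
          (subst (λ k → 2 ^ k * m ≤ length (nbhd blue x Q)) (+-suc i j) p)
    ...   | inj₁ k = inj₁ (biclique-weaken red blue x P Q k)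
    ...   | inj₂ k = inj₂ (biclique-cons blue x P Q k)

-- Paths and cycles as vertex lists, and alternating lists.

module Arcs where

  open import Data.Bool using (Bool; true; false)
  open import Data.List using (List; []; _∷_; _++_; length; map)
  open import Data.List.Membership.Propositional using (_∈_; _∉_)
  open import Data.List.Relation.Binary.Permutation.Propositional using (_↭_; ↭-refl; ↭-trans; prep)
  open import Data.List.Relation.Binary.Permutation.Propositional.Properties using (++-comm)
  open import Data.List.Relation.Binary.Sublist.Propositional using (_⊆_; []; _∷_; _∷ʳ_; minimum; ⊆-refl)
  open import Data.List.Relation.Unary.All as All using (All; []; _∷_)
  open import Data.List.Relation.Unary.AllPairs using (AllPairs; []; _∷_)
  open import Data.List.Relation.Unary.Any using (here; there)
  open import Data.List.Relation.Unary.Unique.Propositional using (Unique)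
  open import Data.Nat using (suc; _≤_; s≤s)
  open import Data.Nat.Properties
  open import Data.Product using (_×_; _,_; proj₁; proj₂) renaming (map to map-×)
  open import Relation.Binary.PropositionalEquality
  open import Relation.Nullary using (¬_)
  open import Defs using (Colour)
  open Ramsey

  module _ {A : Set} where

    lastOf : A → List A → A
    lastOf x []       = x
    lastOf x (y ∷ ys) = lastOf y ys

    path : List A → List (A × A)
    path []           = []
    path (x ∷ [])     = []
    path (x ∷ y ∷ zs) = (x , y) ∷ path (y ∷ zs)

    close : List A → List (A × A)
    close []       = []
    close (x ∷ xs) = (x , lastOf x xs) ∷ []

    -- The flag says whether the list is a closed cycle or an open path.
    arcs : Bool → List A → List (A × A)
    arcs true  xs = close xs ++ path xs
    arcs false xs = path xs

    lastOf-∈ : ∀ x xs → lastOf x xs ∈ x ∷ xs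
    lastOf-∈ x []       = here refl
    lastOf-∈ x (y ∷ ys) = there (lastOf-∈ y ys)

    path-∈ : ∀ xs → All (λ a → proj₁ a ∈ xs × proj₂ a ∈ xs) (path xs)
    path-∈ []           = []
    path-∈ (x ∷ [])     = []
    path-∈ (x ∷ y ∷ zs) = (here refl , there (here refl)) ∷ All.map (map-× there there) (path-∈ (y ∷ zs))

    arcs-∈ : ∀ b xs → All (λ a → proj₁ a ∈ xs × proj₂ a ∈ xs) (arcs b xs)
    arcs-∈ true  []       = []
    arcs-∈ true  (x ∷ xs) = (here refl , lastOf-∈ x xs) ∷ path-∈ (x ∷ xs)
    arcs-∈ false xs       = path-∈ xs

    length-path : ∀ x xs → length (path (x ∷ xs)) ≡ length xs
    length-path x []       = refl
    length-path x (y ∷ ys) = cong suc (length-path y ys)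

    path-++ˡ : ∀ xs ys → path xs ⊆ path (xs ++ ys)
    path-++ˡ []           ys = minimum _
    path-++ˡ (x ∷ [])     ys = minimum _
    path-++ˡ (x ∷ y ∷ zs) ys = refl ∷ path-++ˡ (y ∷ zs) ys

    path-++ʳ : ∀ xs ys → path ys ⊆ path (xs ++ ys)
    path-++ʳ [] ys                 = ⊆-refl
    path-++ʳ (x ∷ []) []           = minimum _
    path-++ʳ (x ∷ []) (y ∷ ys)     = _ ∷ʳ path-++ʳ [] (y ∷ ys)
    path-++ʳ (x ∷ z ∷ zs) ys       = _ ∷ʳ path-++ʳ (z ∷ zs) ys

    DistinctEdges : A × A → A × A → Set
    DistinctEdges (u , v) (u′ , v′) = ¬ (u ≡ u′ × v ≡ v′) × ¬ (u ≡ v′ × v ≡ u′)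

    fresh-vertex-distinct : ∀ {x y xs} {as : List (A × A)} → x ∉ xs →
      All (λ a → proj₁ a ∈ xs × proj₂ a ∈ xs) as → All (DistinctEdges (x , y)) as
    fresh-vertex-distinct {xs = xs} x∉ = All.map λ (p , q) →
      (λ (e , _) → x∉ (subst (_∈ xs) (sym e) p)) , (λ (e , _) → x∉ (subst (_∈ xs) (sym e) q))

    path-distinct : ∀ {xs} → Unique xs → AllPairs DistinctEdges (path xs)
    path-distinct []                       = []
    path-distinct (p ∷ [])                 = []
    path-distinct {x ∷ y ∷ zs} (p ∷ q ∷ u) =
      fresh-vertex-distinct (λ h → All.lookup p h refl) (path-∈ (y ∷ zs)) ∷ path-distinct (q ∷ u)

    -- Every arc after the first of the path avoids the head, so only that first arc could coincide
    -- with the closing one. This happens for two vertices; from three on, the last vertex differs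
    -- from the second.
    arcs-distinct : ∀ b {xs} → Unique xs → 3 ≤ length xs → AllPairs DistinctEdges (arcs b xs)
    arcs-distinct false u _ = path-distinct u
    arcs-distinct true {x ∷ y ∷ z ∷ ws} (p ∷ q ∷ u) _ =
      (((λ (_ , e) → All.lookup q (lastOf-∈ z ws) (sym e)) , (λ (e , _) → All.lookup p (here refl) e))
        ∷ fresh-vertex-distinct (λ h → All.lookup p h refl) (path-∈ (y ∷ z ∷ ws)))
      ∷ path-distinct (p ∷ q ∷ u)
    arcs-distinct true {_ ∷ []}     _ (s≤s ())
    arcs-distinct true {_ ∷ _ ∷ []} _ (s≤s (s≤s ()))

    -- Meant for length Y ≤ length X ≤ 1 + length Y; otherwise part of a list is dropped.
    alt : List A → List A → List A
    alt []      Y = []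
    alt (x ∷ X) Y = x ∷ alt Y X

    alt-↭ : ∀ X Y → length Y ≤ length X → length X ≤ suc (length Y) → alt X Y ↭ X ++ Y
    alt-↭ []      []      _ _ = ↭-refl
    alt-↭ (x ∷ X) Y p (s≤s q) = prep x (↭-trans (alt-↭ Y X q p) (++-comm Y X))

    mutual
      lastOf-alt-same : ∀ x X Y → length X ≡ length Y → lastOf x (alt Y X) ∈ x ∷ X
      lastOf-alt-same x []       []      _ = here refl
      lastOf-alt-same x (x′ ∷ X) (y ∷ Y) e = there (lastOf-alt-long y (x′ ∷ X) Y e)

      lastOf-alt-long : ∀ x X Y → length X ≡ suc (length Y) → lastOf x (alt X Y) ∈ X
      lastOf-alt-long y (x ∷ X) Y e = lastOf-alt-same x X Y (suc-injective e)

    -- An alternating list of odd length, `x ∷ alt Y X`, begins and ends in the same class, so its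
    -- closing edge does not cross.
    lastOf-alt-odd : ∀ x X Y → length X ≡ length Y → 1 ≤ length X → lastOf x (alt Y X) ∈ X
    lastOf-alt-odd x (x′ ∷ X) (y ∷ Y) e _ = lastOf-alt-long y (x′ ∷ X) Y e

  module _ {A B : Set} (f : A → B) where

    lastOf-map : ∀ x xs → lastOf (f x) (map f xs) ≡ f (lastOf x xs)
    lastOf-map x []       = refl
    lastOf-map x (y ∷ ys) = lastOf-map y ys

    path-map : ∀ xs → path (map f xs) ≡ map (map-× f f) (path xs)
    path-map []           = refl
    path-map (x ∷ [])     = refl
    path-map (x ∷ y ∷ zs) = cong ((f x , f y) ∷_) (path-map (y ∷ zs))

    arcs-map : ∀ b xs → arcs b (map f xs) ≡ map (map-× f f) (arcs b xs)
    arcs-map false xs       = path-map xs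
    arcs-map true  []       = refl
    arcs-map true  (x ∷ xs) = cong₂ _∷_ (cong (f x ,_) (lastOf-map x xs)) (path-map (x ∷ xs))

  module _ {V : Set} (col : V → V → Colour) (col-sym : ∀ u v → col u v ≡ col v u) where

    ArcsIn : Colour → List (V × V) → Set
    ArcsIn c = All (λ a → col (proj₁ a) (proj₂ a) ≡ c)

    Cross-swap : ∀ c {X Y} → Cross col c X Y → Cross col c Y X
    Cross-swap c {X} {Y} cr = All.tabulate λ y∈ → All.tabulate λ x∈ →
      trans (col-sym _ _) (All.lookup (All.lookup cr x∈) y∈)

    alt-path : ∀ c X Y → Cross col c X Y → ArcsIn c (path (alt X Y))
    alt-path c []      Y       cr = []
    alt-path c (x ∷ X) []      cr = []
    alt-path c (x ∷ X) (y ∷ Y) cr@((p ∷ ps) ∷ cr′) =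
      p ∷ alt-path c (y ∷ Y) X (Cross-swap c cr′)

    alt-close-even : ∀ c X Y → Cross col c X Y → length X ≡ length Y → ArcsIn c (close (alt X Y))
    alt-close-even c []      Y cr e = []
    alt-close-even c (x ∷ X) Y (p ∷ cr) e = All.lookup p (lastOf-alt-long x Y X (sym e)) ∷ []

    -- Both ends of the list lie in X, so the colour of the closing edge comes from the clique X and
    -- not from the bipartite graph.
    alt-close-odd : ∀ c X Y → Mono col c X → length X ≡ suc (length Y) → 1 ≤ length Y → ArcsIn c
        (close (alt X Y))
    alt-close-odd c (x ∷ X) Y (p ∷ _) e l =
      All.lookup p (lastOf-alt-odd x X Y (suc-injective e) (subst (1 ≤_) (sym (suc-injective e)) l)) ∷ []

    mono-path : ∀ c xs → Mono col c xs → ArcsIn c (path xs)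
    mono-path c []           _                    = []
    mono-path c (x ∷ [])     _                    = []
    mono-path c (x ∷ y ∷ zs) ((p ∷ ps) ∷ q)       = p ∷ mono-path c (y ∷ zs) q

    mono-close : ∀ c xs → 2 ≤ length xs → Mono col c xs → ArcsIn c (close xs)
    mono-close c (x ∷ y ∷ zs) _ (p ∷ _) = All.lookup p (lastOf-∈ y zs) ∷ []
    mono-close c (_ ∷ []) (s≤s ()) _

-- Decomposition of a 2-factor into cycles.

module Cycles where

  open import Data.Bool using (Bool; true; false; T; T?)
  open import Data.Fin using (Fin; zero; suc; _≟_)
  open import Data.Fin.Properties using (any?)
  open import Data.Fin.Subset using (∣_∣)
  open import Data.List using (List; []; _∷_; _++_; length; filter; concat; concatMap; take; drop; allFin)
  open import Data.List.Membership.Propositional using (_∈_; _∉_)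
  open import Data.List.Membership.DecPropositional using () renaming (_∈?_ to mem?)
  open import Data.List.Membership.Propositional.Properties
    using (∈-filter⁺; ∈-filter⁻; ∈-allFin; ∈-++⁺ˡ; ∈-++⁺ʳ; ∈-++⁻)
  open import Data.List.Properties
    using (length-tabulate; length-++; take++drop≡id; length-take; length-drop; ++-identityʳ; concatMap-++)
  open import Data.List.Relation.Binary.Sublist.Propositional using (_⊆_)
  open import Data.List.Relation.Binary.Sublist.Propositional.Properties using (All-resp-⊆)
  import Data.List as List
  import Data.Vec as Vec
  open import Data.List.Relation.Unary.All as All using (All; []; _∷_)
  open import Data.List.Relation.Unary.All.Properties using () renaming (++⁺ to All-++⁺)
  open import Data.List.Relation.Unary.AllPairs using ([]; _∷_)
  open import Data.List.Relation.Unary.Any using (here; there)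
  open import Data.List.Relation.Unary.Unique.Propositional using (Unique)
  open import Data.List.Relation.Unary.Unique.Propositional.Properties
    using (allFin⁺) renaming (filter⁺ to Unique-filter⁺)
  open import Data.Nat using (ℕ; zero; suc; _+_; _*_; _≤_; _<_; z≤n; s≤s; _≤?_)
  open import Data.Nat.Properties hiding (_≟_)
  open import Data.Product using (∃-syntax; _×_; _,_; proj₁; proj₂)
  open import Data.Sum using (_⊎_; inj₁; inj₂; [_,_]′)
  open import Function using (_∘_; id)
  open import Relation.Binary.PropositionalEquality
  open import Relation.Nullary using (¬_; yes; no)
  open import Relation.Nullary.Decidable using (¬?; decidable-stable)
  open import Relation.Nullary.Negation using (contradiction)
  open import Defs
  open ListLemmas
  open Arcs

  unique-length-≤ : ∀ {n} {xs : List (Fin n)} → Unique xs → length xs ≤ n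
  unique-length-≤ {n} u = ≤-trans (unique-⊆-length u (λ _ → ∈-allFin _))
      (≤-reflexive (length-tabulate {n = n} _))

  length-filter-tabulate : ∀ {A : Set} (f : A → Bool) {m} (g : Fin m → A) →
    length (filter (T? ∘ f) (List.tabulate g)) ≡ ∣ Vec.tabulate (f ∘ g) ∣
  length-filter-tabulate f {zero}  g = refl
  length-filter-tabulate f {suc m} g with f (g zero)
  ... | true  = cong suc (length-filter-tabulate f (g ∘ suc))
  ... | false = length-filter-tabulate f (g ∘ suc)

  module _ {n} (G : Graph (Fin n)) where

    E : Fin n → Fin n → Set
    E u v = T (adj G u v)

    E-sym : ∀ {u v} → E u v → E v u
    E-sym {u} {v} = subst T (adj-sym G u v)

    E-irrefl : ∀ {v} → ¬ E v v
    E-irrefl {v} = subst T (adj-irrefl G v)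

    EdgesOf : List (Fin n × Fin n) → Set
    EdgesOf = All (λ a → E (proj₁ a) (proj₂ a))

    IsCycle : List (Fin n) → Set
    IsCycle zs = 3 ≤ length zs × EdgesOf (arcs true zs)

    -- The listed vertices form a union of components, so no walk that starts outside can enter
    -- them.
    Closed : List (Fin n) → Set
    Closed zs = ∀ {v w} → v ∈ zs → E v w → w ∈ zs

    module _ (reg : TwoFactor G) where

      neighbours : ∀ v → ∃[ a ] ∃[ b ] E v a × E v b × a ≢ b × (∀ {w} → E v w → w ≡ a ⊎ w ≡ b)
      neighbours v = go (filter (T? ∘ adj G v) (allFin n))
                        (trans (length-filter-tabulate (adj G v) (λ i → i)) (reg v))
                        (Unique-filter⁺ (T? ∘ adj G v) (allFin⁺ n))
                        (λ h → proj₂ (∈-filter⁻ (T? ∘ adj G v) {xs = allFin n} h))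
                        (λ {w} e → ∈-filter⁺ (T? ∘ adj G v) (∈-allFin w) e)
        where
        go : ∀ xs → length xs ≡ 2 → Unique xs → (∀ {w} → w ∈ xs → E v w) → (∀ {w} → E v w → w ∈ xs) →
             ∃[ a ] ∃[ b ] E v a × E v b × a ≢ b × (∀ {w} → E v w → w ≡ a ⊎ w ≡ b)
        go (a ∷ b ∷ []) _ ((a≢b ∷ _) ∷ _) to from =
          a , b , to (here refl) , to (there (here refl)) , a≢b , λ e → cases (from e)
          where
          cases : ∀ {w} → w ∈ a ∷ b ∷ [] → w ≡ a ⊎ w ≡ b
          cases (here p)         = inj₁ p
          cases (there (here p)) = inj₂ p

      only-two : ∀ {v a b w} → E v a → E v b → a ≢ b → E v w → w ≡ a ⊎ w ≡ b
      only-two {v} ea eb a≢b ew with neighbours v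
      ... | c , d , _ , _ , _ , only with only ea | only eb | only ew
      ... | inj₁ refl | inj₁ refl | _         = contradiction refl a≢b
      ... | inj₂ refl | inj₂ refl | _         = contradiction refl a≢b
      ... | inj₁ refl | inj₂ refl | inj₁ refl = inj₁ refl
      ... | inj₁ refl | inj₂ refl | inj₂ refl = inj₂ refl
      ... | inj₂ refl | inj₁ refl | inj₁ refl = inj₂ refl
      ... | inj₂ refl | inj₁ refl | inj₂ refl = inj₁ refl

      other-neighbour : ∀ {v a} → E v a → ∃[ b ] E v b × b ≢ a
      other-neighbour {v} ea with neighbours v
      ... | c , d , ec , ed , c≢d , only with only ea
      ... | inj₁ refl = d , ed , c≢d ∘ sym
      ... | inj₂ refl = c , ec , c≢d

      -- The path x ∷ x′ ∷ m′ runs from its newest vertex x back to its start s, whose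
      -- successor is p. All neighbours of the vertices strictly between are on the path.
      walk : ∀ {P : Fin n → Set} (P-step : ∀ {v w} → P v → E v w → P w) {s p} → E s p →
             ∀ k x x′ m′ → Unique (x ∷ x′ ∷ m′) →
             EdgesOf (path (x ∷ x′ ∷ m′)) →
             lastOf x′ m′ ≡ s →
             (∀ {v w} → v ∈ m′ → v ≢ s → E v w → w ∈ x′ ∷ m′) →
             (∀ {w} → x′ ≢ s → E x′ w → w ∈ x ∷ x′ ∷ m′) →
             (m′ ≡ [] × x ≡ p) ⊎ p ∈ x′ ∷ m′ →
             All P (x ∷ x′ ∷ m′) →
             n ≤ k + length (x ∷ x′ ∷ m′) →
             ∃[ zs ] Unique zs × IsCycle zs × Closed zs × All P zs × 1 ≤ length zs
      walk P-step {s} {p} esp k x x′ m′ u@(x∉ ∷ u′) es@(exx′ ∷ _) last≡s inner x′-inner p-seen all-P fuel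
        with y , exy , y≢x′ ← other-neighbour exx′
        with mem? _≟_ y (x′ ∷ m′)
      ... | yes (here y≡x′) = contradiction y≡x′ y≢x′
      ... | yes (there y∈m′) with y ≟ s
      -- All neighbours of a vertex strictly between x′ and the start lie in `x′ ∷ m′`, which does
      -- not contain x.
      ...   | no y≢s = contradiction refl (All.lookup x∉ (inner y∈m′ y≢s (E-sym exy)))
      ...   | yes refl =
        x ∷ x′ ∷ m′ , u , (long m′ y∈m′ , subst (E x) (sym last≡s) exy ∷ es) , closed , all-P , s≤s z≤n
        where
        long : ∀ m → y ∈ m → 3 ≤ length (x ∷ x′ ∷ m)
        long (_ ∷ _) _ = s≤s (s≤s (s≤s z≤n))
        p∈ : p ∈ x′ ∷ m′
        p∈ = [ (λ (m′≡[] , _) → contradiction (subst (y ∈_) m′≡[] y∈m′) λ ()) , id ]′ p-seen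
        -- The walk left the start towards p and has come back to it from x. Since p is an earlier
        -- vertex than x, these are two different neighbours, hence all of them.
        closed-s : ∀ {w} → E s w → w ∈ x ∷ x′ ∷ m′
        closed-s esw with only-two esp (E-sym exy) (λ { refl → All.lookup x∉ p∈ refl }) esw
        ... | inj₁ refl = there p∈
        ... | inj₂ refl = here refl
        closed : Closed (x ∷ x′ ∷ m′)
        closed {v} v∈ evw with v ≟ s
        closed v∈ evw | yes refl = closed-s evw
        closed (here refl) evw | no _ with only-two exx′ exy (y≢x′ ∘ sym) evw
        ... | inj₁ refl = there (here refl)
        ... | inj₂ refl = there (there y∈m′)
        closed (there (here refl)) evw | no v≢s = x′-inner v≢s evw
        closed (there (there v∈)) evw | no v≢s = there (inner v∈ v≢s evw)
      walk P-step {s} {p} esp k x x′ m′ u@(x∉ ∷ u′) es@(exx′ ∷ _) last≡s inner x′-inner p-seen all-P fuel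
          | no y∉ = continue k fuel
        where
        y≢ : ∀ {v} → v ∈ x ∷ x′ ∷ m′ → y ≢ v
        y≢ (here refl) refl = E-irrefl exy
        y≢ (there v∈)  refl = y∉ v∈
        inner′ : ∀ {v w} → v ∈ x′ ∷ m′ → v ≢ s → E v w → w ∈ x ∷ x′ ∷ m′
        inner′ (here refl) v≢s e = x′-inner v≢s e
        inner′ (there v∈)  v≢s e = there (inner v∈ v≢s e)
        x-inner : ∀ {w} → x ≢ s → E x w → w ∈ y ∷ x ∷ x′ ∷ m′
        x-inner _ e with only-two exx′ exy (y≢x′ ∘ sym) e
        ... | inj₁ refl = there (there (here refl))
        ... | inj₂ refl = here refl
        p-seen′ : p ∈ x ∷ x′ ∷ m′
        p-seen′ = [ (λ (_ , x≡p) → here (sym x≡p)) , there ]′ p-seen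
        unique-y : Unique (y ∷ x ∷ x′ ∷ m′)
        unique-y = All.tabulate y≢ ∷ u
        continue : ∀ k → n ≤ k + length
            (x ∷ x′ ∷ m′) → ∃[ zs ] Unique zs × IsCycle zs × Closed zs × All _ zs × 1 ≤ length zs
        -- Without fuel the path already has n vertices, and y would be one more.
        continue zero    fuel = contradiction fuel (<⇒≱ (unique-length-≤ unique-y))
        continue (suc k) fuel =
          walk P-step esp k y x (x′ ∷ m′) unique-y (E-sym exy ∷ es) last≡s inner′ x-inner (inj₂ p-seen′)
            (P-step (All.lookup all-P (here refl)) exy ∷ all-P)
            (≤-trans fuel (≤-reflexive (sym (+-suc k _))))

      -- P will be the property of lying outside all earlier cycles. It passes along edges because
      -- those cycles cover a closed set, and so the new cycle is disjoint from them.
      cycle-through : ∀ {P : Fin n → Set} (P-step : ∀ {v w} → P v → E v w → P w) {s} → P s →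
                      ∃[ zs ] Unique zs × IsCycle zs × Closed zs × All P zs × 1 ≤ length zs
      cycle-through P-step {s} Ps with p , _ , esp , _ ← neighbours s =
        walk P-step esp n p s [] (((λ { refl → E-irrefl esp }) ∷ []) ∷ [] ∷ []) (E-sym esp ∷ []) refl
          (λ ()) (λ s≢s → contradiction refl s≢s) (inj₁ (refl , refl)) (P-step Ps esp ∷ Ps ∷ [])
          (m≤m+n n 2)

      extend-decomposition : ∀ k zss → Unique (concat zss) → Closed (concat zss) → All IsCycle zss →
                             n ≤ k + length (concat zss) →
                             ∃[ zss ] Unique (concat zss) × (∀ v → v ∈ concat zss) × All IsCycle zss
      extend-decomposition k zss u closed cyc fuel with any? (λ v → ¬? (mem? _≟_ v (concat zss)))
      ... | no all-in = zss , u , (λ v → decidable-stable (mem? _≟_ v (concat zss)) (λ v∉ → all-in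
          (v , v∉))) , cyc
      ... | yes (v , v∉) with zs , uz , cz , clz , out , pos ← cycle-through {P = _∉ concat zss}
          (λ v∉ e w∈ → v∉ (closed w∈ (E-sym e))) v∉
        = continue k fuel
        where
        u′ : Unique (zs ++ concat zss)
        u′ = Unique-++⁺ uz u (All.lookup out)
        closed′ : Closed (zs ++ concat zss)
        closed′ v∈ e = [ (λ h → ∈-++⁺ˡ (clz h e)) , (λ h → ∈-++⁺ʳ zs (closed h e)) ]′ (∈-++⁻ zs v∈)
        len : suc (length (concat zss)) ≤ length (zs ++ concat zss)
        len = ≤-trans (+-monoˡ-≤ _ pos) (≤-reflexive (sym (length-++ zs)))
        continue : ∀ k → n ≤ k + length (concat zss) → ∃[ zss ] Unique (concat zss) ×
            (∀ v → v ∈ concat zss) × All IsCycle zss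
        continue zero    fuel = contradiction (≤-trans len (unique-length-≤ u′)) (≤⇒≯ fuel)
        continue (suc k) fuel =
          extend-decomposition k (zs ∷ zss) u′ closed′ (cz ∷ cyc)
            (≤-trans fuel (≤-trans (≤-reflexive (sym (+-suc k _))) (+-monoʳ-≤ k len)))

      cycle-decomposition : ∃[ zss ] Unique (concat zss) × (∀ v → v ∈ concat zss) × All IsCycle zss
      cycle-decomposition = extend-decomposition n [] [] (λ ()) [] (m≤m+n n 0)

  -- Cutting the cycles into pieces of bounded length.

  Piece : ℕ → Set
  Piece n = Bool × List (Fin n)

  -- The number of edges by which a piece falls short of its number of vertices.
  opn : Bool → ℕ
  opn true  = 0
  opn false = 1

  verts : ∀ {n} → Piece n → List (Fin n)
  verts = proj₂

  module _ {n} (G : Graph (Fin n)) (M : ℕ) (3≤M : 3 ≤ M) where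

    -- The lower bound M concerns open pieces only: it limits their number, and thereby the number
    -- of lost edges, to n / M. Short cycles stay closed and lose nothing.
    IsPiece : Piece n → Set
    IsPiece (b , xs) = 3 ≤ length xs × length xs ≤ M + M × opn b * M ≤ length xs
                       × EdgesOf G (arcs b xs)

    length-take-M : ∀ (xs : List (Fin n)) → M ≤ length xs → length (take M xs) ≡ M
    length-take-M xs M≤ = trans (length-take M xs) (m≤n⇒m⊓n≡m M≤)

    length-drop-M-≥ : ∀ (xs : List (Fin n)) → M + M < length xs → M ≤ length (drop M xs)
    length-drop-M-≥ xs long = subst (M ≤_) (sym (length-drop M xs)) (m+n≤o⇒m≤o∸n M (<⇒≤ long))

    length-drop-M-≤ : ∀ k (xs : List (Fin n)) → length xs ≤ suc k → M ≤ length xs → length (drop M xs) ≤ k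
    length-drop-M-≤ k xs fuel M≤ = subst (_≤ k) (sym (length-drop M xs))
      (≤-pred (≤-trans (∸-monoʳ-< {o = 0} (≤-trans (s≤s z≤n) 3≤M) M≤) fuel))

    path-take : ∀ (xs : List (Fin n)) → path (take M xs) ⊆ path xs
    path-take xs = subst (λ ys → path (take M xs) ⊆ path ys) (take++drop≡id M xs) (path-++ˡ (take M xs)
        (drop M xs))

    path-drop : ∀ (xs : List (Fin n)) → path (drop M xs) ⊆ path xs
    path-drop xs = subst (λ ys → path (drop M xs) ⊆ path ys) (take++drop≡id M xs) (path-++ʳ (take M xs)
        (drop M xs))

    -- M vertices are split off only while more than 2M remain, so the last piece too has at least M
    -- vertices.
    cut-path : ∀ k xs → length xs ≤ k → M ≤ length xs → EdgesOf G (path xs) →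
               ∃[ ps ] concatMap verts ps ≡ xs × All IsPiece ps
    cut-path k xs fuel M≤ es with length xs ≤? M + M
    ... | yes short = (false , xs) ∷ [] , ++-identityʳ xs ,
          (≤-trans 3≤M M≤ , short , ≤-trans (≤-reflexive (*-identityˡ M)) M≤ , es) ∷ []
    cut-path zero    xs fuel M≤ es | no long = contradiction (≤-trans fuel z≤n) long
    cut-path (suc k) xs fuel M≤ es | no long
      with ps , eq , ok ← cut-path k (drop M xs) (length-drop-M-≤ k xs fuel M≤) (length-drop-M-≥ xs (≰⇒> long))
                            (All-resp-⊆ (path-drop xs) es)
      = (false , take M xs) ∷ ps , trans (cong (take M xs ++_) eq) (take++drop≡id M xs) ,
        (subst (3 ≤_) (sym len) 3≤M , subst (_≤ M + M) (sym len) (m≤m+n M M) ,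
         ≤-reflexive (trans (*-identityˡ M) (sym len)) , All-resp-⊆ (path-take xs) es) ∷ ok
      where
      len : length (take M xs) ≡ M
      len = length-take-M xs M≤

    cut-cycle : ∀ xs → IsCycle G xs → ∃[ ps ] concatMap verts ps ≡ xs × All IsPiece ps
    cut-cycle xs (3≤ , es) with length xs ≤? M + M
    ... | yes short = (true , xs) ∷ [] , ++-identityʳ xs , (3≤ , short , z≤n , es) ∷ []
    ... | no long   = cut-path (length xs) xs ≤-refl (≤-trans (m≤m+n M M) (<⇒≤ (≰⇒> long))) (drop-close xs es)
      where
      drop-close : ∀ xs → EdgesOf G (arcs true xs) → EdgesOf G (path xs)
      drop-close []       _        = []
      drop-close (x ∷ xs) (_ ∷ es) = es

    cut-cycles : ∀ zss → All (IsCycle G) zss → ∃[ ps ] concatMap verts ps ≡ concat zss × All IsPiece ps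
    cut-cycles []         []       = [] , refl , []
    cut-cycles (zs ∷ zss) (c ∷ cs)
      with ps , eq , ok ← cut-cycle zs c | qs , eq′ , ok′ ← cut-cycles zss cs =
      ps ++ qs , trans (concatMap-++ verts ps qs) (cong₂ _++_ eq eq′) , All-++⁺ ok ok′

    piece-decomposition : TwoFactor G →
      ∃[ ps ] Unique (concatMap verts ps) × (∀ v → v ∈ concatMap verts ps) × All IsPiece ps
    piece-decomposition reg with zss , u , all-in , cyc ← cycle-decomposition G reg
      with ps , eq , ok ← cut-cycles zss cyc =
      ps , subst Unique (sym eq) u , (λ v → subst (v ∈_) (sym eq) (all-in v)) , ok

-- From an assignment of pieces to a copy of F.

module Embedding where

  open import Data.Bool using (T)
  open import Data.Fin using (Fin; _≟_; _<?_)
  open import Data.Fin.Properties using (<-cmp)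
  open import Data.Fin.Subset using (⊤) renaming (_∈_ to _∈ˢ_)
  open import Data.Fin.Subset.Properties using (∈⊤)
  open import Data.List using (List; []; _∷_; _++_; length; map; filter; concatMap)
  open import Data.List.Membership.Propositional using (_∈_)
  open import Data.List.Membership.DecPropositional using () renaming (_∈?_ to mem?)
  open import Data.List.Membership.Propositional.Properties
    using (∈-filter⁺; ∈-filter⁻; ∈-allFin; ∈-++⁺ˡ; ∈-++⁺ʳ; ∈-map⁻; ∈-cartesianProduct⁺)
  open import Data.List.Properties
    using (length-++; length-map; length-tabulate; filter-++; map-∘; map-++; map-cong-local; ∷-injectiveˡ; ∷-injectiveʳ)
  open import Data.List.Relation.Unary.All as All using (All; []; _∷_)
  open import Data.List.Relation.Unary.All.Properties using () renaming (++⁺ to All-++⁺; map⁻ to All-map⁻)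
  open import Data.List.Relation.Unary.AllPairs as AllPairs using (AllPairs; []; _∷_)
  open import Data.List.Relation.Unary.AllPairs.Properties
    using () renaming (++⁺ to AllPairs-++⁺; map⁺ to AllPairs-map⁺; filter⁺ to AllPairs-filter⁺)
  open import Data.List.Relation.Unary.Unique.Propositional using (Unique)
  open import Data.List.Relation.Unary.Unique.Propositional.Properties using (allFin⁺)
  open import Data.Nat as ℕ using (ℕ; suc; _+_; _≤_)
  open import Data.Nat.Properties using (≤-antisym; suc-injective; <-irrefl)
  open import Data.Product using (Σ; _×_; _,_; proj₁; proj₂) renaming (map to map-×)
  open import Data.Vec.Properties.WithK using ([]=-irrelevant)
  open import Function using (_∘_)
  open import Function.Bundles using (mk↔ₛ′)
  open import Relation.Binary.Definitions using (tri<; tri≈; tri>)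
  open import Relation.Binary.PropositionalEquality
  open import Relation.Nullary using (yes; no)
  open import Relation.Nullary.Negation using (contradiction)
  open import Defs
  open ListLemmas
  open Arcs
  open Cycles

  full : ∀ {n} {xs : List (Fin n)} → Unique xs → length xs ≡ n → ∀ v → v ∈ xs
  full {n} {xs} u len v with mem? _≟_ v xs
  ... | yes v∈ = v∈
  ... | no v∉  = contradiction (unique-length-≤ (All.tabulate (λ { h refl → v∉ h }) ∷ u))
                   (λ h → <-irrefl refl (subst (λ k → suc k ≤ n) len h))

  covering-length : ∀ {n} {xs : List (Fin n)} → Unique xs → (∀ v → v ∈ xs) → length xs ≡ n
  covering-length {n} {xs} u all-in = ≤-antisym (unique-length-≤ u)
    (subst (_≤ length xs) (length-tabulate {n = n} (λ i → i)) (unique-⊆-length (allFin⁺ n) (λ _ → all-in _)))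

  ++-injective : ∀ {A : Set}
      (as cs : List A) {bs ds} → length as ≡ length cs → as ++ bs ≡ cs ++ ds → as ≡ cs × bs ≡ ds
  ++-injective []       []       _ e = refl , e
  ++-injective (a ∷ as) (c ∷ cs) l e with p , q ← ++-injective as cs (suc-injective l) (∷-injectiveʳ e) =
    cong₂ _∷_ (∷-injectiveˡ e) p , q

  module _ {n : ℕ} where

    -- The value outside fs is irrelevant: fs will list all vertices.
    assoc : List (Fin n) → List (Fin n) → Fin n → Fin n
    assoc (f ∷ fs) (k ∷ ks) v with v ≟ f
    ... | yes _ = k
    ... | no _  = assoc fs ks v
    assoc _ _ v = v

    assoc-head : ∀ f fs k ks → assoc (f ∷ fs) (k ∷ ks) f ≡ k
    assoc-head f fs k ks with f ≟ f
    ... | yes _  = refl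
    ... | no f≢f = contradiction refl f≢f

    assoc-tail : ∀ {f v} fs k ks → f ≢ v → assoc (f ∷ fs) (k ∷ ks) v ≡ assoc fs ks v
    assoc-tail {f} {v} fs k ks f≢v with v ≟ f
    ... | yes v≡f = contradiction (sym v≡f) f≢v
    ... | no _    = refl

    map-assoc : ∀ fs ks → Unique fs → length ks ≡ length fs → map (assoc fs ks) fs ≡ ks
    map-assoc []       []       _       _ = refl
    map-assoc (f ∷ fs) (k ∷ ks) (p ∷ u) l = cong₂ _∷_ (assoc-head f fs k ks)
      (trans (map-cong-local (All.map (assoc-tail fs k ks) p)) (map-assoc fs ks u (suc-injective l)))

    -- The two maps carry the list fs to ks and back, so their composition fixes fs entry by entry.
    assoc-inverse : ∀ {fs ks} → Unique fs → Unique ks → length ks ≡ length fs →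
                    ∀ {v} → v ∈ fs → assoc ks fs (assoc fs ks v) ≡ v
    assoc-inverse {fs} {ks} uf uk l = map-id-∈
      (trans (map-∘ fs) (trans (cong (map (assoc ks fs)) (map-assoc fs ks uf l)) (map-assoc ks fs uk (sym l))))

  -- Each piece of the 2-factor with the list of the images of its vertices, in order.
  Assignment : ℕ → Set
  Assignment n = List (Piece n × List (Fin n))

  module _ {n : ℕ} where

    sources : Assignment n → List (Fin n)
    sources = concatMap (verts ∘ proj₁)

    images : Assignment n → List (Fin n)
    images = concatMap proj₂

    imageArcs : Assignment n → List (Fin n × Fin n)
    imageArcs = concatMap λ ((b , _) , ys) → arcs b ys

    SameLength : Assignment n → Set
    SameLength = All λ (p , ys) → length ys ≡ length (verts p)

    length-images : ∀ {asg} → SameLength asg → length (images asg) ≡ length (sources asg)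
    length-images []                          = refl
    length-images {((_ , xs) , ys) ∷ asg} (e ∷ es) =
      trans (length-++ ys) (trans (cong₂ _+_ e (length-images es)) (sym (length-++ xs)))

    map-images : ∀ {σ : Fin n → Fin n} {asg} → SameLength asg → map σ (images asg) ≡ sources asg →
                 All (λ (p , ys) → map σ ys ≡ verts p) asg
    map-images []                                   _ = []
    map-images {σ} {((_ , xs) , ys) ∷ asg} (e ∷ es) eq
      with p , q ← ++-injective (map σ ys) xs (trans (length-map σ ys) e)
          (trans (sym (map-++ σ ys (images asg))) eq)
      = p ∷ map-images es q

    imageArcs-∈ : ∀ asg → All (λ a → proj₁ a ∈ images asg × proj₂ a ∈ images asg) (imageArcs asg)
    imageArcs-∈ []                     = []
    imageArcs-∈ (((b , _) , ys) ∷ asg) = All-++⁺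
      (All.map (map-× ∈-++⁺ˡ ∈-++⁺ˡ) (arcs-∈ b ys))
      (All.map (map-× (∈-++⁺ʳ ys) (∈-++⁺ʳ ys)) (imageArcs-∈ asg))

    imageArcs-distinct : ∀ {asg} → Unique (images asg) → All (λ (_ , ys) → 3 ≤ length ys) asg →
                         AllPairs DistinctEdges (imageArcs asg)
    imageArcs-distinct {[]}                     u []       = []
    imageArcs-distinct {((b , _) , ys) ∷ asg} u (l ∷ ls) with u₁ , u₂ , dis ← Unique-++⁻ ys u =
      AllPairs-++⁺ (arcs-distinct b u₁ l) (imageArcs-distinct u₂ ls)
        (All.map (λ (p , _) → fresh-vertex-distinct (dis p) (imageArcs-∈ asg)) (arcs-∈ b ys))

    -- Arcs point in either direction along a piece, whereas `edgesOfColour` lists every edge with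
    -- its smaller end first.
    sortPair : Fin n × Fin n → Fin n × Fin n
    sortPair (u , v) with u <? v
    ... | yes _ = u , v
    ... | no _  = v , u

    sortPair-injective : ∀ {a b} → DistinctEdges a b → sortPair a ≢ sortPair b
    sortPair-injective {u , v} {u′ , v′} (d , d′) eq with u <? v | u′ <? v′ | eq
    ... | yes _ | yes _ | refl = d (refl , refl)
    ... | yes _ | no _  | refl = d′ (refl , refl)
    ... | no _  | yes _ | refl = d′ (refl , refl)
    ... | no _  | no _  | refl = d (refl , refl)

    module _ (χ : EdgeColouring (K n)) where

      count : Colour → List (Fin n × Fin n) → ℕ
      count c as = length (filter (λ a → colour χ (proj₁ a) (proj₂ a) ≟ᶜ c) as)

      count-++ : ∀ c as bs → count c (as ++ bs) ≡ count c as + count c bs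
      count-++ c as bs = trans (cong length (filter-++ _ as bs)) (length-++ (filter _ as))

      module _ (F : Graph (Fin n)) (asg : Assignment n)
               (source-unique : Unique (sources asg)) (source-all : ∀ v → v ∈ sources asg)
               (image-unique : Unique (images asg)) (same : SameLength asg)
               (long : All (λ (p , _) → 3 ≤ length (verts p)) asg)
               (edges : All (λ ((b , xs) , _) → EdgesOf F (arcs b xs)) asg) where

        private
          lengths : length (images asg) ≡ length (sources asg)
          lengths = length-images same

          -- π carries F into the complete graph. The copy is defined through its inverse σ, which
          -- lets an edge be tested by looking it up in F.
          π σ : Fin n → Fin n
          π = assoc (sources asg) (images asg)
          σ = assoc (images asg) (sources asg)

          σπ : ∀ v → σ (π v) ≡ v
          σπ v = assoc-inverse source-unique image-unique lengths (source-all v)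

          πσ : ∀ v → π (σ v) ≡ v
          πσ v = assoc-inverse image-unique source-unique (sym lengths)
            (full image-unique (trans lengths (covering-length source-unique source-all)) v)

          H : Subgraph (K n)
          H = record
            { vertices    = ⊤
            ; edge        = λ u v → adj F (σ u) (σ v)
            ; edge-sym    = λ u v → adj-sym F (σ u) (σ v)
            ; edge-irrefl = λ v → adj-irrefl F (σ v)
            ; edge⇒adj    = distinct-ends
            ; edge⇒∈      = λ _ _ _ → ∈⊤
            }
            where
            distinct-ends : ∀ u v → T (adj F (σ u) (σ v)) → T (distinct u v)
            distinct-ends u v e with u ≟ v
            ... | yes refl = E-irrefl F e
            ... | no _     = _

          Σ-≡ : {x y : Σ (Fin n) (_∈ˢ ⊤)} → proj₁ x ≡ proj₁ y → x ≡ y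
          Σ-≡ {u , p} {_ , q} refl = cong (u ,_) ([]=-irrelevant p q)

          imageArcs-edges : All (λ a → E F (σ (proj₁ a)) (σ (proj₂ a))) (imageArcs asg)
          imageArcs-edges = go edges (map-images same (map-assoc (images asg) (sources asg) image-unique
              (sym lengths)))
            where
            go : ∀ {asg} → All (λ ((b , xs) , _) → EdgesOf F (arcs b xs)) asg →
                 All (λ (p , ys) → map σ ys ≡ verts p) asg → All (λ a → E F (σ (proj₁ a)) (σ (proj₂ a)))
                     (imageArcs asg)
            go []                              []       = []
            go {((b , xs) , ys) ∷ asg} (e ∷ es) (q ∷ qs) =
              All-++⁺ (All-map⁻ (subst (EdgesOf F) (trans (cong (arcs b) (sym q)) (arcs-map σ b ys)) e))
                  (go es qs)

          image-long : ∀ {asg} → SameLength asg → All (λ (p , _) → 3 ≤ length (verts {n} p)) asg →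
                       All (λ (_ , ys) → 3 ≤ length ys) asg
          image-long []       []       = []
          image-long (e ∷ es) (l ∷ ls) = subst (3 ≤_) (sym e) l ∷ image-long es ls

          sorted-edge : ∀ c {a} → E F (σ (proj₁ a)) (σ (proj₂ a)) → colour χ (proj₁ a) (proj₂ a) ≡ c →
                        sortPair a ∈ edgesOfColour χ c H
          sorted-edge c {u , v} e p with u <? v
          ... | yes u<v = ∈-filter⁺ _ (∈-cartesianProduct⁺ (∈-allFin u) (∈-allFin v)) (u<v , e , p)
          ... | no u≮v with <-cmp u v
          ...   | tri< u<v _ _  = contradiction u<v u≮v
          ...   | tri≈ _ refl _ = contradiction e (E-irrefl F)
          ...   | tri> _ _ v<u  = ∈-filter⁺ _ (∈-cartesianProduct⁺ (∈-allFin v) (∈-allFin u))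
                                    (v<u , E-sym F e , trans (colour-sym χ v u) p)

        copyOf : Copy F (K n)
        copyOf = record
          { subgraph = H
          ; iso = record
            { bijection = mk↔ₛ′ (λ v → π v , ∈⊤) (λ u → σ (proj₁ u)) (λ u → Σ-≡ (πσ (proj₁ u))) σπ
            ; preserves = λ u v → sym (cong₂ (adj F) (σπ u) (σπ v))
            }
          }

        -- Sorting is injective on arcs that differ as undirected edges, so the coloured arcs become
        -- distinct members of `edgesOfColour`. There is only an inequality because the copy also
        -- contains the edges lost by cutting.
        count-≤-edges : ∀ c → count c (imageArcs asg) ≤ #edgesOfColour χ c (subgraph copyOf)
        count-≤-edges c = subst (_≤ #edgesOfColour χ c H) (length-map sortPair coloured) (unique-⊆-length
          (AllPairs-map⁺ (AllPairs.map sortPair-injective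
            (AllPairs-filter⁺ _ (imageArcs-distinct image-unique (image-long same long)))))
          member)
          where
          coloured : List (Fin n × Fin n)
          coloured = filter (λ a → colour χ (proj₁ a) (proj₂ a) ≟ᶜ c) (imageArcs asg)
          member : ∀ {a} → a ∈ map sortPair coloured → a ∈ edgesOfColour χ c H
          member a∈ with a , a∈′ , refl ← ∈-map⁻ sortPair a∈
            with a∈″ , p ← ∈-filter⁻ (λ a → colour χ (proj₁ a) (proj₂ a) ≟ᶜ c) {xs = imageArcs asg} a∈′ =
            sorted-edge c (All.lookup imageArcs-edges a∈″) p

-- Monochromatic cliques covering nearly all vertices.

module CliqueCover where

  open import Data.Fin using (Fin; _≟_)
  open import Data.List using (List; []; _∷_; _++_; length; filter; concat; allFin)
  open import Data.List.Membership.DecPropositional using () renaming (_∈?_ to mem?)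
  open import Data.List.Membership.Propositional using (_∈_; _∉_)
  open import Data.List.Membership.Propositional.Properties using (∈-filter⁺; ∈-filter⁻; ∈-++⁺ˡ; ∈-++⁺ʳ; ∈-++⁻)
  open import Data.List.Properties using (length-++; length-tabulate; length-filter; filter-++)
  open import Data.List.Relation.Binary.Sublist.Propositional using (_⊆_; lookup)
  open import Data.List.Relation.Binary.Sublist.Propositional.Properties using (filter-⊆)
  open import Data.List.Relation.Unary.All as All using (All; []; _∷_)
  open import Data.List.Relation.Unary.AllPairs using ([]; _∷_)
  open import Data.List.Relation.Unary.Unique.Propositional using (Unique)
  open import Data.List.Relation.Unary.Unique.Propositional.Properties
    using (allFin⁺) renaming (filter⁺ to Unique-filter⁺)
  open import Data.Nat using (ℕ; zero; suc; _+_; _*_; _^_; _≤_; z≤n; s≤s; _≤?_)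
  open import Data.Nat.Properties hiding (_≟_)
  open import Data.Product using (∃-syntax; _×_; _,_; proj₂)
  open import Data.Sum using (_⊎_; inj₁; inj₂; [_,_]′)
  open import Function using (_∘_; id)
  open import Relation.Binary.PropositionalEquality
  open import Relation.Nullary using (yes; no)
  open import Relation.Nullary.Decidable using (¬?; toSum)
  open import Relation.Nullary.Negation using (contradiction)
  open import Defs
  open ListLemmas
  open Ramsey
  open Cycles using (unique-length-≤)

  module _ {n : ℕ} where

    fresh : List (Fin n) → List (Fin n) → List (Fin n)
    fresh U = filter (λ v → ¬? (mem? _≟_ v U))

    within : List (Fin n) → List (Fin n) → List (Fin n)
    within U = filter (λ v → mem? _≟_ v U)

    fresh-∈ : ∀ U xs {v} → v ∈ fresh U xs → v ∈ xs × v ∉ U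
    fresh-∈ U xs = ∈-filter⁻ (λ v → ¬? (mem? _≟_ v U)) {xs = xs}

    within-∈ : ∀ U xs {v} → v ∈ within U xs → v ∈ xs × v ∈ U
    within-∈ U xs = ∈-filter⁻ (λ v → mem? _≟_ v U) {xs = xs}

    fresh-unique : ∀ U {xs} → Unique xs → Unique (fresh U xs)
    fresh-unique U = Unique-filter⁺ (λ v → ¬? (mem? _≟_ v U))

    -- The members of xs that are not fresh are counted among the entries of U instead. When U is a
    -- concatenation of images, this count can be bounded block by block.
    length-fresh-within : ∀ U xs → Unique xs → length xs ≤ length (fresh U xs) + length (within xs U)
    length-fresh-within U xs u = ≤-trans
      (filter-split (λ v → ¬? (mem? _≟_ v U)) (λ v → mem? _≟_ v U) xs
        λ v → [ inj₂ , inj₁ ]′ (toSum (mem? _≟_ v U)))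
      (+-monoʳ-≤ (length (fresh U xs)) (unique-⊆-length (Unique-filter⁺ (λ v → mem? _≟_ v U) u)
        λ h → let (p , q) = within-∈ U xs h in ∈-filter⁺ (λ v → mem? _≟_ v xs) q p))

    length-fresh : ∀ U xs → Unique xs → length xs ≤ length (fresh U xs) + length U
    length-fresh U xs u = ≤-trans (length-fresh-within U xs u)
      (+-monoʳ-≤ (length (fresh U xs)) (length-filter (λ v → mem? _≟_ v xs) U))

    length-fresh-++ : ∀ ys U xs → Unique xs → length (fresh U xs) ≤ length (fresh (ys ++ U) xs) + length ys
    length-fresh-++ ys U xs u = ≤-trans (length-fresh ys (fresh U xs) (fresh-unique U u))
      (+-monoˡ-≤ (length ys) (unique-⊆-length (fresh-unique ys (fresh-unique U u)) λ h →
        let (p , q)  = fresh-∈ ys (fresh U xs) h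
            (p′ , r) = fresh-∈ U xs p
        in ∈-filter⁺ (λ v → ¬? (mem? _≟_ v (ys ++ U))) p′ ([ q , r ]′ ∘ ∈-++⁻ ys)))

    n≤fresh : ∀ U → n ≤ length (fresh U (allFin n)) + length U
    n≤fresh U = subst (_≤ length (fresh U (allFin n)) + length U) (length-tabulate {n = n} id)
      (length-fresh U (allFin n) (allFin⁺ n))

  other : Colour → Colour
  other red  = blue
  other blue = red

  by : ∀ {A : Set} → Colour → A → A → Colour → A
  by red  a b red  = a
  by red  a b blue = b
  by blue a b red  = b
  by blue a b blue = a

  by-elim : ∀ {A : Set} (P : Colour → A → Set) m {a b} → P m a → P (other m) b → ∀ c → P c (by m a b c)
  by-elim P red  p q red  = p
  by-elim P red  p q blue = q
  by-elim P blue p q red  = q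
  by-elim P blue p q blue = p

  same-or-other : ∀ m c → c ≡ m ⊎ c ≡ other m
  same-or-other red  red  = inj₁ refl
  same-or-other red  blue = inj₂ refl
  same-or-other blue red  = inj₂ refl
  same-or-other blue blue = inj₁ refl

  module _ {n : ℕ} (χ : EdgeColouring (K n)) where

    record Cliques (t : ℕ) : Set where
      field
        cliques  : Colour → List (List (Fin n))
        mono     : ∀ c → All (Mono (colour χ) c) (cliques c)
        size     : ∀ c → All (λ C → length C ≡ t) (cliques c)
        unique   : ∀ c → Unique (concat (cliques c))
        disjoint : ∀ c {v} → v ∈ concat (cliques c) → v ∉ concat (cliques (other c))

      side : Colour → List (Fin n)
      side c = concat (cliques c)

    open Cliques

    noCliques : ∀ t → Cliques t
    noCliques t = record
      { cliques = λ _ → [] ; mono = λ _ → [] ; size = λ _ → [] ; unique = λ _ → [] ; disjoint = λ _ () }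

    addClique : ∀ {t} (𝒞 : Cliques t) c ys → Mono (colour χ) c ys → length ys ≡ t → Unique ys →
                (∀ d {v} → v ∈ ys → v ∉ side 𝒞 d) → Cliques t
    addClique {t} 𝒞 c ys m l u new = record
      { cliques  = by c (ys ∷ cliques 𝒞 c) (cliques 𝒞 (other c))
      ; mono     = by-elim (λ d → All (Mono (colour χ) d)) c (m ∷ mono 𝒞 c) (mono 𝒞 (other c))
      ; size     = by-elim (λ _ → All (λ (C : List (Fin n)) → length C ≡ t)) c (l ∷ size 𝒞 c) (size 𝒞 (other c))
      ; unique   = by-elim (λ _ Cs → Unique (concat Cs)) c (Unique-++⁺ u (unique 𝒞 c) (new c))
          (unique 𝒞 (other c))
      ; disjoint = disj c new (disjoint 𝒞)
      }
      where
      disj : ∀ c → (∀ d {v} → v ∈ ys → v ∉ side 𝒞 d) → (∀ d {v} → v ∈ side 𝒞 d → v ∉ side 𝒞 (other d)) →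
             ∀ d {v} → v ∈ concat (by c (ys ∷ cliques 𝒞 c) (cliques 𝒞 (other c)) d) →
                       v ∉ concat (by c (ys ∷ cliques 𝒞 c) (cliques 𝒞 (other c)) (other d))
      disj red  new old red  h k = [ (λ p → new blue p k) , (λ p → old red p k) ]′ (∈-++⁻ ys h)
      disj red  new old blue h k = [ (λ p → new blue p h) , (λ p → old red p h) ]′ (∈-++⁻ ys k)
      disj blue new old blue h k = [ (λ p → new red p k) , (λ p → old blue p k) ]′ (∈-++⁻ ys h)
      disj blue new old red  h k = [ (λ p → new red p h) , (λ p → old blue p h) ]′ (∈-++⁻ ys k)

    covered : ∀ {t} → Cliques t → ℕ
    covered 𝒞 = length (side 𝒞 red) + length (side 𝒞 blue)

    covered-add : ∀ {t} (𝒞 : Cliques t) c ys m l u new → covered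
        (addClique 𝒞 c ys m l u new) ≡ length ys + covered 𝒞
    covered-add 𝒞 red  ys m l u new =
      trans (cong (_+ length (side 𝒞 blue)) (length-++ ys)) (+-assoc (length ys) _ _)
    covered-add 𝒞 blue ys m l u new =
      trans (cong (length (side 𝒞 red) +_) (length-++ ys))
        (trans (sym (+-assoc (length (side 𝒞 red)) (length ys) _))
          (trans (cong (_+ length (side 𝒞 blue)) (+-comm (length (side 𝒞 red)) (length ys)))
              (+-assoc (length ys) _ _)))

    covered-≤ : ∀ {t} (𝒞 : Cliques t) → covered 𝒞 ≤ n
    covered-≤ 𝒞 = subst (_≤ n) (length-++ (side 𝒞 red)) (unique-length-≤
      (Unique-++⁺ (unique 𝒞 red) (unique 𝒞 blue) (disjoint 𝒞 red)))

    -- Ramsey's theorem yields another clique as long as the uncovered vertices are at least as many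
    -- as its bound. Every clique is nonempty, so the covered part grows and k bounds the number of
    -- rounds.
    extend-cliques : ∀ t k (𝒞 : Cliques (suc t)) → n ≤ k + covered 𝒞 →
                     ∃[ 𝒞′ ] n ≤ 2 ^ (suc t + suc t) + covered {suc t} 𝒞′
    extend-cliques t k 𝒞 fuel with 2 ^ (suc t + suc t) ≤? length (fresh (side 𝒞 red ++ side 𝒞 blue) (allFin n))
    ... | no few = 𝒞 , ≤-trans (n≤fresh (side 𝒞 red ++ side 𝒞 blue))
                         (+-mono-≤ (<⇒≤ (≰⇒> few)) (≤-reflexive (length-++ (side 𝒞 red))))
    ... | yes many = [ (λ (ys , τ , l , m) → continue red ys τ l m k fuel)
                     , (λ (ys , τ , l , m) → continue blue ys τ l m k fuel) ]′
                     (ramsey (colour χ) (suc t) (suc t) rest many)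
      where
      U rest : List (Fin n)
      U    = side 𝒞 red ++ side 𝒞 blue
      rest = fresh U (allFin n)

      continue : ∀ c ys → ys ⊆ rest → length ys ≡ suc t → Mono (colour χ) c ys → ∀ k → n ≤ k + covered 𝒞 →
                 ∃[ 𝒞′ ] n ≤ 2 ^ (suc t + suc t) + covered {suc t} 𝒞′
      continue c ys τ l m k fuel = go k fuel
        where
        new : ∀ d {v} → v ∈ ys → v ∉ side 𝒞 d
        new red  v∈ = proj₂ (fresh-∈ U (allFin n) (lookup τ v∈)) ∘ ∈-++⁺ˡ
        new blue v∈ = proj₂ (fresh-∈ U (allFin n) (lookup τ v∈)) ∘ ∈-++⁺ʳ (side 𝒞 red)

        𝒞⁺ : Cliques (suc t)
        𝒞⁺ = addClique 𝒞 c ys m l (AllPairs-resp-⊇ τ (fresh-unique U (allFin⁺ n))) new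

        grown : suc (covered 𝒞) ≤ covered 𝒞⁺
        grown = ≤-trans (s≤s (m≤n+m (covered 𝒞) t))
          (≤-reflexive (sym (trans (covered-add 𝒞 c ys m l (AllPairs-resp-⊇ τ (fresh-unique U
              (allFin⁺ n))) new) (cong (_+ covered 𝒞) l))))

        go : ∀ k → n ≤ k + covered 𝒞 → ∃[ 𝒞′ ] n ≤ 2 ^ (suc t + suc t) + covered {suc t} 𝒞′
        go zero    fuel = contradiction (≤-trans grown (covered-≤ 𝒞⁺)) (≤⇒≯ fuel)
        go (suc k) fuel = extend-cliques t k 𝒞⁺
          (≤-trans fuel (≤-trans (≤-reflexive (sym (+-suc k _))) (+-monoʳ-≤ k grown)))

    clique-cover : ∀ t → ∃[ 𝒞 ] n ≤ 2 ^ (suc t + suc t) + covered {suc t} 𝒞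
    clique-cover t = extend-cliques t n (noCliques (suc t)) (m≤m+n n 0)

    length-concat : ∀ {t} (Cs : List (List (Fin n))) → All (λ C → length C ≡ t) Cs → length
        (concat Cs) ≡ length Cs * t
    length-concat []       []       = refl
    length-concat (C ∷ Cs) (e ∷ es) = trans (length-++ C) (cong₂ _+_ e (length-concat Cs es))

    FreshClique : ℕ → Colour → List (Fin n) → List (Fin n) → Set
    FreshClique T c U S = ∃[ P ] Mono (colour χ) c P × Unique P × (∀ {v} → v ∈ P → v ∈ S × v ∉ U) × T ≤ length P

    -- If no clique has T fresh vertices left, each wastes fewer than T. The cliques will be chosen
    -- much larger than T, which makes this waste a small fraction of the side.
    find-fresh-clique : ∀ T c U Cs → All (Mono (colour χ) c) Cs → Unique (concat Cs) →
      FreshClique T c U (concat Cs) ⊎ length (fresh U (concat Cs)) ≤ length Cs * T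
    find-fresh-clique T c U []       []       u = inj₂ z≤n
    find-fresh-clique T c U (C ∷ Cs) (m ∷ ms) u with uC , uCs , _ ← Unique-++⁻ C u | T ≤? length (fresh U C)
    ... | yes big = inj₁ (fresh U C , AllPairs-resp-⊇ (filter-⊆ _ C) m , fresh-unique U uC ,
                          (λ h → let (p , q) = fresh-∈ U C h in ∈-++⁺ˡ p , q) , big)
    ... | no small with find-fresh-clique T c U Cs ms uCs
    ...   | inj₁ (P , mP , uP , inP , big) = inj₁ (P , mP , uP ,
        (λ h → let (p , q) = inP h in ∈-++⁺ʳ C p , q) , big)
    ...   | inj₂ few = inj₂ (subst (_≤ T + length Cs * T)
                         (sym (trans (cong length (filter-++ _ C (concat Cs))) (length-++ (fresh U C))))
                         (+-mono-≤ (<⇒≤ (≰⇒> small)) few))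

-- Blocks across the two sides and their greedy construction.

module Blocks where

  open import Data.Bool using (true; false)
  open import Data.Fin using (Fin; _≟_)
  open import Data.List using (List; []; _∷_; _++_; length; map; take)
  open import Data.List.Membership.DecPropositional using () renaming (_∈?_ to mem?)
  open import Data.List.Membership.Propositional using (_∈_; _∉_)
  open import Data.List.Membership.Propositional.Properties using (∈-++⁻)
  open import Data.List.Properties
    using (length-++; length-take; length-filter; filter-++; filter-all; filter-none; map-++)
  open import Data.List.Relation.Binary.Permutation.Propositional using (_↭_; ↭⇒↭ₛ; ↭-sym; ↭-refl; ↭-trans)
  open import Data.List.Relation.Binary.Permutation.Propositional.Properties
    using (↭-length; ∈-resp-↭; filter-↭; shift; map⁺)
  open import Data.List.Relation.Binary.Sublist.Propositional using (_⊆_; lookup; ⊆-trans)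
  open import Data.List.Relation.Binary.Sublist.Propositional.Properties using (take-⊆; All-resp-⊆)
  open import Data.List.Relation.Unary.All as All using (All; []; _∷_)
  open import Data.List.Relation.Unary.AllPairs using ([]; _∷_)
  open import Data.List.Relation.Unary.All.Properties using () renaming (++⁺ to All-++⁺)
  import Data.List.Relation.Binary.Permutation.Setoid.Properties as ↭ₛ
  open import Data.List.Relation.Unary.Unique.Propositional using (Unique)
  open import Data.Nat using (ℕ; zero; suc; _+_; _*_; _^_; _≤_; z≤n; s≤s; ⌊_/2⌋; ⌈_/2⌉)
  open import Data.Nat.ListAction using (sum)
  open import Data.Nat.ListAction.Properties using (sum-++; sum-↭)
  open import Data.Nat.Properties hiding (_≟_)
  open import Data.Nat.Tactic.RingSolver using (solve-∀)
  open import Data.Product using (∃-syntax; Σ-syntax; _×_; _,_; proj₁; proj₂)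
  open import Data.Sum using (_⊎_; inj₁; inj₂; [_,_]′)
  open import Function using (_∘_)
  open import Relation.Binary.PropositionalEquality
  open import Defs
  open ListLemmas
  open Ramsey
  open Arcs
  open Cycles
  open Embedding
  open CliqueCover

  total : ∀ {A : Set} → (A → ℕ) → List A → ℕ
  total f xs = sum (map f xs)

  total-↭ : ∀ {A : Set} (f : A → ℕ) {xs ys} → xs ↭ ys → total f xs ≡ total f ys
  total-↭ f p = sum-↭ (map⁺ f p)

  total-++ : ∀ {A : Set} (f : A → ℕ) xs ys → total f (xs ++ ys) ≡ total f xs + total f ys
  total-++ f xs ys = trans (cong sum (map-++ f xs ys)) (sum-++ (map f xs) (map f ys))

  Unique-resp-↭ : ∀ {A : Set} {xs ys : List A} → xs ↭ ys → Unique xs → Unique ys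
  Unique-resp-↭ {A} = ↭ₛ.Unique-resp-↭ (setoid A) ∘ ↭⇒↭ₛ

  ⌈/2⌉≤1+⌊/2⌋ : ∀ m → ⌈ m /2⌉ ≤ suc ⌊ m /2⌋
  ⌈/2⌉≤1+⌊/2⌋ zero          = z≤n
  ⌈/2⌉≤1+⌊/2⌋ (suc zero)    = s≤s z≤n
  ⌈/2⌉≤1+⌊/2⌋ (suc (suc m)) = s≤s (⌈/2⌉≤1+⌊/2⌋ m)

  ⌈/2⌉-cases : ∀ m → ⌈ m /2⌉ ≡ ⌊ m /2⌋ ⊎ ⌈ m /2⌉ ≡ suc ⌊ m /2⌋
  ⌈/2⌉-cases zero          = inj₁ refl
  ⌈/2⌉-cases (suc zero)    = inj₂ refl
  ⌈/2⌉-cases (suc (suc m)) = [ inj₁ ∘ cong suc , inj₂ ∘ cong suc ]′ (⌈/2⌉-cases m)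

  -- The larger half exceeds the smaller by at most one, and the smaller half is at least one, so
  -- the larger is at most twice the smaller. Triangles attain the factor 3, from which the n/3 in
  -- the bound on the total gain comes.
  ≤3*⌊/2⌋ : ∀ m → 3 ≤ m → m ≤ 3 * ⌊ m /2⌋
  ≤3*⌊/2⌋ m long = ≤-trans (≤-reflexive (sym (⌊n/2⌋+⌈n/2⌉≡n m))) (+-monoʳ-≤ ⌊ m /2⌋
    (≤-trans (⌈/2⌉≤1+⌊/2⌋ m) (≤-trans (+-monoˡ-≤ ⌊ m /2⌋ (⌊n/2⌋-mono long))
      (+-monoʳ-≤ ⌊ m /2⌋ (≤-reflexive (sym (+-identityʳ ⌊ m /2⌋)))))))

  module _ {n : ℕ} (χ : EdgeColouring (K n)) where

    Coloured : Colour → List (Fin n × Fin n) → Set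
    Coloured = ArcsIn (colour χ) (colour-sym χ)

    -- An open piece is credited with the edge that cutting its cycle has lost.
    worth : Colour → Piece n → List (Fin n) → ℕ
    worth c (b , _) ys = count χ c (arcs b ys) + opn b

    count-all : ∀ c {as} → Coloured c as → count χ c as ≡ length as
    count-all c p = cong length (filter-all (λ a → colour χ (proj₁ a) (proj₂ a) ≟ᶜ c) p)

    -- The unit of loss is the closing edge of a closed piece, whose colour is not controlled here.
    worth-path : ∀ c p {ys} → Coloured c (path ys) → length ys ≤ suc (worth c p ys)
    worth-path c p           {[]}     _  = z≤n
    worth-path c (false , _) {y ∷ ys} cs =
      s≤s (≤-trans (≤-reflexive (sym (trans (count-all c cs) (length-path y ys)))) (m≤m+n _ 1))
    worth-path c (true , _)  {y ∷ ys} cs =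
      s≤s (≤-trans (≤-reflexive (sym (trans (count-all c cs) (length-path y ys))))
        (≤-trans (m≤n+m _ (count χ c (close (y ∷ ys))))
          (≤-reflexive (sym (trans (+-identityʳ _) (count-++ χ c (close (y ∷ ys)) (path (y ∷ ys))))))))

    worth-closed : ∀ c p {ys} → Coloured c (path ys) → Coloured c (close ys) → length ys ≤ worth c p ys
    worth-closed c p           {[]}     _  _  = z≤n
    worth-closed c (false , _) {y ∷ ys} cs _  =
      ≤-reflexive (sym (trans (+-comm _ 1) (cong suc (trans (count-all c cs) (length-path y ys)))))
    worth-closed c (true , _)  {y ∷ ys} cs ds =
      ≤-reflexive (sym (trans (+-identityʳ _) (trans (count-all c (All-++⁺ ds cs))
          (cong suc (length-path y ys)))))

    module _ {t : ℕ} (𝒞 : Cliques χ t) where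

      open Cliques 𝒞

      S : Colour → List (Fin n)
      S = side

      halfLength : Piece n → ℕ
      halfLength p = ⌊ length (verts p) /2⌋

      -- A piece placed across the two sides: share c bounds its number of vertices in S c, and
      -- hue is the colour of the bipartite graph it runs through. The gain over filling only
      -- cliques of colour hue is `half`.
      record Block : Set where
        field
          piece       : Piece n
          image       : List (Fin n)
          hue         : Colour
          share       : Colour → ℕ
          same-length : length image ≡ length (verts piece)
          shares      : share red + share blue ≡ length (verts piece)
          third≤half  : length (verts piece) ≤ 3 * halfLength piece
          half≤share  : ∀ c → halfLength piece ≤ share c
          value       : halfLength piece + share hue ≤ worth hue piece image
          within-side : ∀ c → length (within (S c) image) ≤ share c

        half : ℕ
        half = halfLength piece

        placed : Piece n × List (Fin n)
        placed = piece , image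

      open Block

      minority : Piece n → ℕ
      minority = halfLength

      majority : Piece n → ℕ
      majority p = ⌈ length (verts p) /2⌉

      within-none : ∀ (U xs : List (Fin n)) → (∀ {v} → v ∈ xs → v ∉ U) → length (within U xs) ≡ 0
      within-none U xs out = cong length (filter-none (λ v → mem? _≟_ v U) (All.tabulate out))

      -- The image alternates between X and Y, so all its path edges have colour c. With halves of
      -- equal size the closing edge crosses as well; with unequal halves it lies inside X and has
      -- colour m.
      alternating-block : ∀ m p → 3 ≤ length (verts p) → ∀ c X Y →
        length X ≡ majority p → length Y ≡ minority p → Mono (colour χ) m X → Cross (colour χ) c X Y →
        (∀ {v} → v ∈ X → v ∈ S m) → (∀ {v} → v ∈ Y → v ∈ S (other m)) →
        Σ[ b ∈ Block ] piece b ≡ p × share b ≡ by m (majority p) (minority p) × image b ↭ X ++ Y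
      alternating-block m p long c X Y lX lY mono-X cross X⊆ Y⊆ = block , refl , refl , alternate
        where
        k k′ ℓ : ℕ
        k  = minority p
        k′ = majority p
        ℓ  = length (verts p)

        k+k′ : k + k′ ≡ ℓ
        k+k′ = ⌊n/2⌋+⌈n/2⌉≡n ℓ

        alternate : alt X Y ↭ X ++ Y
        alternate = alt-↭ X Y (subst₂ _≤_ (sym lY) (sym lX) (⌊n/2⌋≤⌈n/2⌉ ℓ))
                              (subst₂ _≤_ (sym lX) (cong suc (sym lY)) (⌈/2⌉≤1+⌊/2⌋ ℓ))

        len : length (alt X Y) ≡ ℓ
        len = trans (↭-length alternate) (trans (length-++ X) (trans (cong₂ _+_ lX lY)
            (trans (+-comm k′ k) k+k′)))

        path-coloured : Coloured c (path (alt X Y))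
        path-coloured = alt-path (colour χ) (colour-sym χ) c X Y cross

        -- If the closing edge also has the hue, the worth is the whole length `k + k′`, which is
        -- enough even when the side of the hue has the larger share.
        full-value : Coloured c (close (alt X Y)) → ∀ {s} → s ≤ k′ → k + s ≤ worth c p (alt X Y)
        full-value cl s≤ = ≤-trans (+-monoʳ-≤ k s≤)
          (≤-trans (≤-reflexive (trans k+k′ (sym len))) (worth-closed c p path-coloured cl))

        shareₘ : Colour → ℕ
        shareₘ = by m k′ k

        share≤ : ∀ d → shareₘ d ≤ k′
        share≤ = by-elim (λ _ s → s ≤ k′) m ≤-refl (⌊n/2⌋≤⌈n/2⌉ ℓ)

        odd-value : k′ ≡ suc k → k + shareₘ c ≤ worth c p (alt X Y)
        odd-value k′≡ with same-or-other m c
        ... | inj₁ refl = full-value (alt-close-odd (colour χ) (colour-sym χ) m X Y mono-X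
                            (trans lX (trans k′≡ (cong suc (sym lY)))) (subst (1 ≤_) (sym lY)
                                (⌊n/2⌋-mono long))) (share≤ c)
        -- Here the hue belongs to the side with the smaller share k. The length is `2k + 1`, so the
        -- path alone supplies the required `k + k`.
        ... | inj₂ refl = subst (λ s → k + s ≤ worth c p (alt X Y)) (sym (minor-share m))
                            (≤-pred (≤-trans (≤-reflexive (trans (sym (+-suc k k))
                                (trans (cong (k +_) (sym k′≡)) (trans k+k′ (sym len)))))
                               (worth-path c p path-coloured)))
          where
          minor-share : ∀ m → by m k′ k (other m) ≡ k
          minor-share red  = refl
          minor-share blue = refl

        block : Block
        block = record
          { piece       = p
          ; image       = alt X Y
          ; hue         = c
          ; share       = shareₘ
          ; same-length = len
          ; shares      = shares-total m
          ; third≤half  = ≤3*⌊/2⌋ ℓ long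
          ; half≤share  = by-elim (λ _ s → k ≤ s) m (⌊n/2⌋≤⌈n/2⌉ ℓ) ≤-refl
          ; value       = [ (λ e → full-value (alt-close-even (colour χ) (colour-sym χ) c X Y cross
                                     (trans lX (trans e (sym lY)))) (share≤ c))
                          , odd-value ]′ (⌈/2⌉-cases ℓ)
          ; within-side = by-elim (λ d s → length (within (S d) (alt X Y)) ≤ s) m
              (≤-trans (≤-reflexive (split (S m)))
                (≤-trans (+-mono-≤ (≤-trans (length-filter _ X) (≤-reflexive lX))
                  (≤-reflexive (within-none (S m) Y (λ h i → disjoint m i (Y⊆ h)))))
                      (≤-reflexive (+-identityʳ k′))))
              (≤-trans (≤-reflexive (split (S (other m))))
                (+-mono-≤ (≤-reflexive (within-none (S (other m)) X (λ h → disjoint m (X⊆ h))))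
                  (≤-trans (length-filter _ Y) (≤-reflexive lY))))
          }
          where
          shares-total : ∀ m → by m k′ k red + by m k′ k blue ≡ ℓ
          shares-total red  = trans (+-comm k′ k) k+k′
          shares-total blue = k+k′
          split : ∀ U → length (within U (alt X Y)) ≡ length (within U X) + length (within U Y)
          split U = trans (↭-length (filter-↭ (λ v → mem? _≟_ v U) alternate))
            (trans (cong length (filter-++ (λ v → mem? _≟_ v U) X Y)) (length-++ (within U X)))

      module _ (L : ℕ) where

        -- What `bipartite-ramsey` asks of Q to produce a biclique with L vertices on either side.
        -- By `double≤threshold` it also meets the demand on P.
        threshold : ℕ
        threshold = 2 ^ (L + L) * L

        double≤threshold : L + L ≤ threshold
        double≤threshold = go L
          where
          go : ∀ L → L + L ≤ 2 ^ (L + L) * L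
          go zero    = z≤n
          go (suc l) = subst (_≤ 2 ^ (suc l + suc l) * suc l) (cong (suc l +_) (+-identityʳ (suc l)))
            (*-monoˡ-≤ (suc l) (m≤m*n 2 (2 ^ (l + suc l)) {{m^n≢0 2 (l + suc l)}}))

        Placeable : Piece n → Set
        Placeable p = 3 ≤ length (verts p) × length (verts p) ≤ L

        -- The biclique comes with a colour that cannot be chosen, and that colour becomes the hue.
        -- Its sides have at least L vertices and are truncated to the two halves of p, the larger
        -- half on side m.
        block-from-cliques : ∀ U m p → Placeable p →
          FreshClique χ threshold m U (S m) → FreshClique χ threshold (other m) U (S (other m)) →
          Σ[ b ∈ Block ] piece b ≡ p × share b ≡ by m (majority p) (minority p) ×
            Unique (image b) × (∀ {v} → v ∈ image b → v ∉ U)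
        block-from-cliques U m p (long , short) (P , mono-P , uP , P∈ , bigP) (Q , _ , uQ , Q∈ , bigQ) =
          [ build red , build blue ]′ (bipartite-ramsey (colour χ) L L L P Q
              (≤-trans double≤threshold bigP) bigQ)
          where
          build : ∀ c → Biclique (colour χ) c L L P Q →
            Σ[ b ∈ Block ] piece b ≡ p × share b ≡ by m (majority p) (minority p) ×
              Unique (image b) × (∀ {v} → v ∈ image b → v ∉ U)
          build c (X , Y , τ , σ , lX , lY , cross) = assemble (alternating-block m p long c X₀ Y₀
              (trans (length-take (majority p) X) (m≤n⇒m⊓n≡m (≤-trans (⌈n/2⌉≤n _) (≤-trans short
                  (≤-reflexive (sym lX))))))
              (trans (length-take (minority p) Y) (m≤n⇒m⊓n≡m (≤-trans (⌊n/2⌋≤n _) (≤-trans short lY))))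
              (AllPairs-resp-⊇ X₀⊆P mono-P)
              (All-resp-⊆ (take-⊆ (majority p) X) (All.map (All-resp-⊆ (take-⊆ (minority p) Y)) cross))
              (proj₁ ∘ P∈ ∘ lookup X₀⊆P) (proj₁ ∘ Q∈ ∘ lookup Y₀⊆Q))
            where
            X₀ Y₀ : List (Fin n)
            X₀ = take (majority p) X
            Y₀ = take (minority p) Y
            X₀⊆P : X₀ ⊆ P
            X₀⊆P = ⊆-trans (take-⊆ (majority p) X) τ
            Y₀⊆Q : Y₀ ⊆ Q
            Y₀⊆Q = ⊆-trans (take-⊆ (minority p) Y) σ
            assemble : Σ[ b ∈ Block ] piece b ≡ p × share b ≡ by m (majority p)
                (minority p) × image b ↭ X₀ ++ Y₀ →
              Σ[ b ∈ Block ] piece b ≡ p × share b ≡ by m (majority p) (minority p) ×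
                Unique (image b) × (∀ {v} → v ∈ image b → v ∉ U)
            assemble (b , e₁ , e₂ , perm) = b , e₁ , e₂
              , Unique-resp-↭ (↭-sym perm) (Unique-++⁺ (AllPairs-resp-⊇ X₀⊆P uP) (AllPairs-resp-⊇ Y₀⊆Q uQ)
                  (λ h k → disjoint m (proj₁ (P∈ (lookup X₀⊆P h))) (proj₁ (Q∈ (lookup Y₀⊆Q k)))))
              , λ h → [ proj₂ ∘ P∈ ∘ lookup X₀⊆P , proj₂ ∘ Q∈ ∘ lookup Y₀⊆Q ]′ (∈-++⁻ X₀ (∈-resp-↭ perm h))

        G : List Block → ℕ
        G = total half

        used : Colour → List Block → ℕ
        used c = total (λ b → share b c)

        -- Either side c has at most one vertex more left than the other side, or the other
        -- side has always received the smaller half so far.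
        Balanced : Colour → List Block → Set
        Balanced c bs = length (S c) + used (other c) bs ≤ suc (length (S (other c)) + used c bs)
                        ⊎ G bs ≡ used (other c) bs

        Exhausted : Colour → List Block → Set
        Exhausted c bs = length (fresh (images (map placed bs)) (S c)) ≤ length (cliques c) * threshold

        -- Side m loses at least as many vertices as the other side, so its lead does not grow. If
        -- instead the other side has received only smaller halves, it now receives another one.
        Balanced-major : ∀ m b bs → share b ≡ by m (majority (piece b)) (minority (piece b)) →
                         Balanced m bs → Balanced m (b ∷ bs)
        Balanced-major m b bs refl-share bal rewrite refl-share = go m bal
          where
          ℓ = length (verts (piece b))
          rearrange : ∀ x y z w k k′ → k ≤ k′ → x + y ≤ suc (z + w) → x + (k + y) ≤ suc (z + (k′ + w))
          rearrange x y z w k k′ k≤ h = ≤-trans (≤-reflexive (lem x y k)) (≤-trans (+-mono-≤ k≤ h)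
              (≤-reflexive (lem′ z w k′)))
            where
            lem : ∀ x y k → x + (k + y) ≡ k + (x + y)
            lem = solve-∀
            lem′ : ∀ z w k → k + suc (z + w) ≡ suc (z + (k + w))
            lem′ = solve-∀
          go : ∀ m → Balanced m bs →
               length (S m) + (by m (majority (piece b)) (minority (piece b)) (other m) + used (other m) bs) ≤
                 suc (length (S (other m)) + (by m (majority (piece b)) (minority (piece b)) m + used m bs))
               ⊎ half b + G bs ≡ by m (majority (piece b)) (minority (piece b)) (other m) + used (other m) bs
          go red  (inj₁ h) = inj₁ (rearrange (length (S red)) _ (length (S blue)) _ _ _ (⌊n/2⌋≤⌈n/2⌉ ℓ) h)
          go red  (inj₂ e) = inj₂ (cong (half b +_) e)
          go blue (inj₁ h) = inj₁ (rearrange (length (S blue)) _ (length (S red)) _ _ _ (⌊n/2⌋≤⌈n/2⌉ ℓ) h)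
          go blue (inj₂ e) = inj₂ (cong (half b +_) e)

        -- Before the step this side had no more vertices left than side m, and it now loses at most
        -- one vertex less. The first alternative thus holds afresh.
        Balanced-minor : ∀ m b bs → share b ≡ by m (majority (piece b)) (minority (piece b)) →
                         length (S (other m)) + used m bs ≤ length (S m) + used (other m) bs →
                         Balanced (other m) (b ∷ bs)
        Balanced-minor m b bs refl-share more rewrite refl-share = inj₁ (go m more)
          where
          ℓ = length (verts (piece b))
          rearrange : ∀ x y z w k k′ → k′ ≤ suc k → x + y ≤ z + w → x + (k′ + y) ≤ suc (z + (k + w))
          rearrange x y z w k k′ k′≤ h = ≤-trans (≤-reflexive (lem x y k′)) (≤-trans (+-mono-≤ k′≤ h)
              (≤-reflexive (lem′ z w k)))
            where
            lem : ∀ x y k → x + (k + y) ≡ k + (x + y)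
            lem = solve-∀
            lem′ : ∀ z w k → suc k + (z + w) ≡ suc (z + (k + w))
            lem′ = solve-∀
          go : ∀ m → length (S (other m)) + used m bs ≤ length (S m) + used (other m) bs →
               length (S (other m)) + (by m (majority (piece b)) (minority (piece b))
                   (other (other m)) + used (other (other m)) bs) ≤
                 suc (length (S (other (other m))) + (by m (majority (piece b)) (minority (piece b))
                     (other m) + used (other m) bs))
          go red  h = rearrange (length (S blue)) _ (length (S red)) _ _ _ (⌈/2⌉≤1+⌊/2⌋ ℓ) h
          go blue h = rearrange (length (S red)) _ (length (S blue)) _ _ _ (⌈/2⌉≤1+⌊/2⌋ ℓ) h

        larger-side : ∀ bs → ∃[ m ] length (S (other m)) + used m bs ≤ length (S m) + used (other m) bs
        larger-side bs with ≤-total (length (S blue) + used red bs) (length (S red) + used blue bs)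
        ... | inj₁ h = red , h
        ... | inj₂ h = blue , h

        both-balanced : ∀ m {bs} → Balanced m bs → Balanced (other m) bs → ∀ c → Balanced c bs
        both-balanced red  p q red  = p
        both-balanced red  p q blue = q
        both-balanced blue p q red  = q
        both-balanced blue p q blue = p

        build-blocks : ∀ ps bs → All Placeable ps → Unique (images (map placed bs)) → (∀ c → Balanced c bs) →
          ∃[ bs′ ] ∃[ rest ] map piece bs′ ++ rest ↭ map piece bs ++ ps × Unique (images (map placed bs′)) ×
            (∀ c → Balanced c bs′) × (rest ≡ [] ⊎ ∃[ c ] Exhausted c bs′)
        build-blocks []       bs _        u bal = bs , [] , ↭-refl , u , bal , inj₁ refl
        build-blocks (p ∷ ps) bs (ok ∷ oks) u bal with m , more ← larger-side bs
          with find-fresh-clique χ threshold m (images (map placed bs)) (cliques m) (mono m) (unique m)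
             | find-fresh-clique χ threshold (other m) (images (map placed bs)) (cliques (other m))
                 (mono (other m)) (unique (other m))
        ... | inj₂ few | _        = bs , p ∷ ps , ↭-refl , u , bal , inj₂ (m , few)
        ... | inj₁ _   | inj₂ few = bs , p ∷ ps , ↭-refl , u , bal , inj₂ (other m , few)
        ... | inj₁ P   | inj₁ Q
          with b , refl , sh , ub , new ← block-from-cliques (images (map placed bs)) m p ok P Q
          with bs′ , rest , perm , r ← build-blocks ps (b ∷ bs) oks (Unique-++⁺ ub u new)
                 (both-balanced m {b ∷ bs} (Balanced-major m b bs sh (bal m)) (Balanced-minor m b bs sh more))
          = bs′ , rest , ↭-trans perm (↭-sym (shift (piece b) (map piece bs) ps)) , r

-- Completing the blocks for one colour.

module Completion where

  open import Data.Fin using (Fin)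
  open import Data.List using (List; []; _∷_; _++_; length; map; filter; concatMap; take; allFin)
  open import Data.List.Membership.Propositional using (_∈_; _∉_)
  open import Data.List.Properties
    using (length-++; length-take; filter-++; map-++; concatMap-++; map-∘; ++-assoc)
  open import Data.List.Relation.Binary.Permutation.Propositional
    using (_↭_; ↭-sym; ↭-refl; ↭-trans; ↭-reflexive; prep; swap; refl; trans)
  open import Data.List.Relation.Binary.Permutation.Propositional.Properties
    using (shifts; shift; map⁺; ++-comm; ++⁺ʳ; ++⁺ˡ; All-resp-↭)
  open import Data.List.Relation.Binary.Sublist.Propositional using (lookup)
  open import Data.List.Relation.Binary.Sublist.Propositional.Properties using (take-⊆)
  open import Data.List.Relation.Unary.All as All using (All; []; _∷_)
  open import Data.List.Relation.Unary.All.Properties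
    using (all-filter) renaming (map⁺ to All-map⁺; ++⁺ to All-++⁺; ++⁻ˡ to All-++⁻ˡ)
  open import Data.List.Relation.Unary.AllPairs using ([]; _∷_)
  open import Data.List.Relation.Unary.Unique.Propositional using (Unique)
  open import Data.List.Relation.Unary.Unique.Propositional.Properties using (allFin⁺)
  open import Data.Nat using (ℕ; _+_; _*_; _≤_; z≤n)
  open import Data.Nat.ListAction using (sum)
  open import Data.Nat.Properties
  open import Data.Nat.Tactic.RingSolver using (solve-∀)
  open import Data.Product using (∃-syntax; _×_; _,_; proj₁; proj₂)
  open import Data.Sum using (_⊎_; inj₁; inj₂; [_,_]′)
  open import Function using (_∘_)
  open import Relation.Binary.PropositionalEquality as ≡ using (_≡_; cong; cong₂; sym; subst)
  open import Defs
  open ListLemmas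
  open Ramsey
  open Arcs
  open Cycles
  open Embedding
  open CliqueCover
  open Blocks

  concatMap-↭ : ∀ {A B : Set} (f : A → List B) {xs ys} → xs ↭ ys → concatMap f xs ↭ concatMap f ys
  concatMap-↭ f refl         = ↭-refl
  concatMap-↭ f (prep x p)   = ++⁺ˡ (f x) (concatMap-↭ f p)
  concatMap-↭ f (swap x y p) = ↭-trans (++⁺ˡ (f x) (++⁺ˡ (f y) (concatMap-↭ f p))) (shifts (f x) (f y))
  concatMap-↭ f (trans p q)  = ↭-trans (concatMap-↭ f p) (concatMap-↭ f q)

  total-≤ : ∀ {A : Set} (f g : A → ℕ) {xs} → All (λ x → f x ≤ g x) xs → total f xs ≤ total g xs
  total-≤ f g []       = z≤n
  total-≤ f g (p ∷ ps) = +-mono-≤ p (total-≤ f g ps)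

  total-+ : ∀ {A : Set} (f g : A → ℕ) xs → total (λ x → f x + g x) xs ≡ total f xs + total g xs
  total-+ f g []       = ≡.refl
  total-+ f g (x ∷ xs) = ≡.trans (cong (f x + g x +_) (total-+ f g xs)) (lem (f x) (g x) _ _)
    where
    lem : ∀ a b c d → a + b + (c + d) ≡ a + c + (b + d)
    lem = solve-∀

  total-* : ∀ {A : Set} k (f : A → ℕ) xs → total (λ x → k * f x) xs ≡ k * total f xs
  total-* k f []       = sym (*-zeroʳ k)
  total-* k f (x ∷ xs) = ≡.trans (cong (k * f x +_) (total-* k f xs)) (sym (*-distribˡ-+ k (f x) _))

  total-map : ∀ {A B : Set} (f : B → ℕ) (g : A → B) xs → total f (map g xs) ≡ total (f ∘ g) xs
  total-map f g xs = cong sum (sym (map-∘ xs))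

  colour-partition : ∀ {A : Set} (h : A → Colour) xs →
                     xs ↭ filter (λ x → h x ≟ᶜ red) xs ++ filter (λ x → h x ≟ᶜ blue) xs
  colour-partition h []       = ↭-refl
  colour-partition h (x ∷ xs) with h x
  ... | red  = prep x (colour-partition h xs)
  ... | blue = ↭-trans (prep x (colour-partition h xs)) (↭-sym (shift x (filter (λ x → h x ≟ᶜ red) xs) _))

  colour-partition-at : ∀ {A : Set} (h : A → Colour) c xs →
                        xs ↭ filter (λ x → h x ≟ᶜ c) xs ++ filter (λ x → h x ≟ᶜ other c) xs
  colour-partition-at h red  xs = colour-partition h xs
  colour-partition-at h blue xs = ↭-trans (colour-partition h xs) (++-comm (filter (λ x → h x ≟ᶜ red) xs) _)

  order : ∀ {n} → Piece n → ℕ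
  order p = length (verts p)

  total-order : ∀ {n} (ps : List (Piece n)) → total order ps ≡ length (concatMap verts ps)
  total-order []       = ≡.refl
  total-order (p ∷ ps) = ≡.trans (cong (order p +_) (total-order ps)) (sym (length-++ (verts p)))

  openness : ∀ {n} → Piece n → ℕ
  openness p = opn (proj₁ p)

  module _ {n : ℕ} where

    -- U holds the vertices taken already; uniqueness of the joint list makes the new images avoid
    -- them.
    Extension : List (Fin n) → List (Piece n) → Assignment n → Set
    Extension U ps extra = map proj₁ extra ≡ ps × Unique (images extra ++ U) × SameLength extra

    extension-cons : ∀ {U p ys ps extra} → length ys ≡ order p → Extension (ys ++ U) ps extra →
                     Extension U (p ∷ ps) ((p , ys) ∷ extra)
    extension-cons {U} {p} {ys} {ps} {extra} l (e , u , s) = cong (p ∷_) e ,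
      Unique-resp-↭ (↭-sym (↭-trans (↭-reflexive (++-assoc ys (images extra) U))
          (shifts ys (images extra)))) u ,
      l ∷ s

    room : ∀ (U ys : List (Fin n)) (p : Piece n) ps → length ys ≡ order p → total order
        (p ∷ ps) + length U ≤ n →
           total order ps + length (ys ++ U) ≤ n
    room U ys p ps l h = ≤-trans (≤-reflexive (≡.trans (cong (total order ps +_) (≡.trans (length-++ ys)
        (cong (_+ length U) l)))
      (lem (total order ps) (order p) (length U)))) h
      where
      lem : ∀ a b c → a + (b + c) ≡ b + a + c
      lem = solve-∀

    take-new : ∀ {U P : List (Fin n)} k → Unique P → (∀ {v} → v ∈ P → v ∉ U) → Unique U → Unique (take k P ++ U)
    take-new {U} {P} k uP new uU = Unique-++⁺ (AllPairs-resp-⊇ (take-⊆ k P) uP) uU (new ∘ lookup (take-⊆ k P))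

    length-take-≤ : ∀ k (P : List (Fin n)) → k ≤ length P → length (take k P) ≡ k
    length-take-≤ k P h = ≡.trans (length-take k P) (m≤n⇒m⊓n≡m h)

    -- Once side c is used up, the remaining pieces only need some place, so that the copy spans all
    -- vertices. Nothing is claimed about the colours of their edges.
    place-anywhere : ∀ U ps → Unique U → total order ps + length U ≤ n → ∃[ extra ] Extension U ps extra
    place-anywhere U []       uU h = [] , ≡.refl , uU , []
    place-anywhere U (p ∷ ps) uU h =
      let ys           = take (order p) rest
          extra , ext  = place-anywhere (ys ++ U) ps
                           (take-new (order p) (fresh-unique U (allFin⁺ n)) (proj₂ ∘ fresh-∈ U (allFin n)) uU)
                           (room U ys p ps enough h)
      in (p , ys) ∷ extra , extension-cons {U} {p} {ys} {ps} {extra} enough ext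
      where
      rest : List (Fin n)
      rest = fresh U (allFin n)
      enough : length (take (order p) rest) ≡ order p
      enough = length-take-≤ (order p) rest (+-cancelʳ-≤ (length U) _ _
        (≤-trans (+-monoˡ-≤ (length U) (m≤m+n (order p) (total order ps))) (≤-trans h (n≤fresh U))))

  module _ {n : ℕ} (χ : EdgeColouring (K n)) {t : ℕ} (𝒞 : Cliques χ t) (L : ℕ) where

    open Cliques 𝒞
    open Block

    private
      T : ℕ
      T = threshold χ 𝒞 L

      Slack : Colour → ℕ
      Slack c = length (cliques c) * T

    totalWorth : Colour → Assignment n → ℕ
    totalWorth c = total (λ (p , ys) → worth χ c p ys)

    totalWorth-count : ∀ c asg → totalWorth c asg ≡ count χ c (imageArcs asg) + total openness (map proj₁ asg)
    totalWorth-count c []                     = ≡.refl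
    totalWorth-count c (((b , xs) , ys) ∷ asg) =
      ≡.trans (cong (count χ c (arcs b ys) + opn b +_) (totalWorth-count c asg))
        (≡.trans (lem (count χ c (arcs b ys)) (opn b) _ _)
            (cong (_+ (opn b + total openness (map proj₁ asg))) (sym (count-++ χ c (arcs b ys)
            (imageArcs asg)))))
      where
      lem : ∀ a b c d → a + b + (c + d) ≡ a + c + (b + d)
      lem = solve-∀

    L≤T : L ≤ T
    L≤T = ≤-trans (m≤m+n L L) (double≤threshold χ 𝒞 L)

    -- A piece inside a clique of colour c is worth its number of vertices, which bounds the number
    -- of fresh vertices it consumes. So either all pieces earn their full order, or the worth
    -- accounts for the whole free part of the side up to the slack.
    fill : ∀ c U ps → All (Placeable χ 𝒞 L) ps → Unique U → total order ps + length U ≤ n →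
      ∃[ extra ] Extension U ps extra ×
        (total order ps ≤ totalWorth c extra ⊎ length (fresh U (side c)) ≤ totalWorth c extra + Slack c)
    fill c U []       _                     uU h = [] , (≡.refl , uU , []) , inj₁ z≤n
    fill c U (p ∷ ps) ((long , short) ∷ ok) uU h
      with find-fresh-clique χ T c U (cliques c) (mono c) (unique c)
    ... | inj₂ few = let extra , ext = place-anywhere U (p ∷ ps) uU h
                     in extra , ext , inj₂ (≤-trans few (m≤n+m _ (totalWorth c extra)))
    ... | inj₁ (P , mono-P , uP , P∈ , big) = continue (fill c (ys ++ U) ps ok (take-new (order p) uP
        (proj₂ ∘ P∈) uU) (room U ys p ps enough h))
      where
      ys : List (Fin n)
      ys = take (order p) P
      enough : length ys ≡ order p
      enough = length-take-≤ (order p) P (≤-trans short (≤-trans L≤T big))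
      mono-ys : Mono (colour χ) c ys
      mono-ys = AllPairs-resp-⊇ (take-⊆ (order p) P) mono-P
      gain : order p ≤ worth χ c p ys
      gain = subst (_≤ worth χ c p ys) enough (worth-closed χ c p
        (mono-path (colour χ) (colour-sym χ) c ys mono-ys)
        (mono-close (colour χ) (colour-sym χ) c ys (≤-trans (n≤1+n 2)
            (subst (3 ≤_) (sym enough) long)) mono-ys))
      continue : ∃[ extra ] Extension (ys ++ U) ps extra ×
                   (total order ps ≤ totalWorth c extra ⊎ length (fresh (ys ++ U)
                       (side c)) ≤ totalWorth c extra + Slack c) →
                 ∃[ extra ] Extension U (p ∷ ps) extra ×
                   (total order (p ∷ ps) ≤ totalWorth c extra ⊎ length
                       (fresh U (side c)) ≤ totalWorth c extra + Slack c)
      continue (extra , ext , inj₁ all-placed) =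
        (p , ys) ∷ extra , extension-cons {n} {U} {p} {ys} {ps} {extra} enough ext , inj₁
            (+-mono-≤ gain all-placed)
      continue (extra , ext , inj₂ few) =
        (p , ys) ∷ extra , extension-cons {n} {U} {p} {ys} {ps} {extra} enough ext ,
        inj₂ (≤-trans (length-fresh-++ ys U (side c) (unique c))
          (≤-trans (+-mono-≤ few (≤-trans (≤-reflexive enough) gain))
            (≤-reflexive (lem (totalWorth c extra) (Slack c) (worth χ c p ys)))))
        where
        lem : ∀ a b c → a + b + c ≡ c + a + b
        lem = solve-∀

    kept : Colour → List (Block χ 𝒞) → List (Block χ 𝒞)
    kept c = filter (λ b → hue b ≟ᶜ c)

    imagesOf : List (Block χ 𝒞) → List (Fin n)
    imagesOf bs = images (map placed bs)

    kept-worth : ∀ c bs → G χ 𝒞 L (kept c bs) + used χ 𝒞 L c (kept c bs) ≤ totalWorth c (map placed (kept c bs))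
    kept-worth c bs = ≤-trans (≤-reflexive (sym (total-+ half (λ b → share b c) (kept c bs))))
      (≤-trans (total-≤ (λ b → half b + share b c) (λ b → worth χ c (piece b) (image b))
          (All.map (λ {b} → bound b) (all-filter (λ b → hue b ≟ᶜ c) bs)))
        (≤-reflexive (sym (total-map (λ (p , ys) → worth χ c p ys) placed (kept c bs)))))
      where
      bound : ∀ b → hue b ≡ c → half b + share b c ≤ worth χ c (piece b) (image b)
      bound b ≡.refl = value b

    within-≤-used : ∀ c bs → length (within (side c) (imagesOf bs)) ≤ used χ 𝒞 L c bs
    within-≤-used c []       = z≤n
    within-≤-used c (b ∷ bs) = ≤-trans (≤-reflexive (≡.trans (cong length (filter-++ _ (image b)
        (imagesOf bs))) (length-++ (within (side c) (image b)))))
      (+-mono-≤ (within-side b c) (within-≤-used c bs))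

    -- A piece has at most `3k` vertices and `k + share c` is at least `2k`. This serves the case
    -- where the pieces run out before side c does.
    two-thirds : ∀ c bs → 2 * total order (map piece bs) ≤ 3 * (G χ 𝒞 L bs + used χ 𝒞 L c bs)
    two-thirds c bs = ≤-trans (≤-reflexive (≡.trans (cong (2 *_) (total-map order piece bs))
        (sym (total-* 2 (order ∘ piece) bs))))
      (≤-trans (total-≤ (λ b → 2 * order (piece b)) (λ b → 3 * (half b + share b c)) {bs}
          (All.tabulate λ {b} _ → bound b))
        (≤-reflexive (≡.trans (total-* 3 (λ b → half b + share b c) bs)
            (cong (3 *_) (total-+ half (λ b → share b c) bs)))))
      where
      bound : ∀ b → 2 * order (piece b) ≤ 3 * (half b + share b c)
      bound b = ≤-trans (*-monoʳ-≤ 2 (third≤half b)) (≤-trans (≤-reflexive (lem (half b)))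
          (*-monoʳ-≤ 3 (+-monoʳ-≤ (half b) (half≤share b c))))
        where
        lem : ∀ k → 2 * (3 * k) ≡ 3 * (k + k)
        lem = solve-∀

    -- The alternatives in `bound` are the two ways in which `fill` ends. If all pieces found a
    -- place, colour c alone has two thirds; if the side was used up, the surplus of the kept blocks
    -- comes on top of its size.
    record Completed (c : Colour) (ps : List (Piece n)) (bs : List (Block χ 𝒞)) : Set where
      field
        assignment  : Assignment n
        pieces      : map proj₁ assignment ↭ ps
        disjoint-im : Unique (images assignment)
        same        : SameLength assignment
        bound       : 2 * total order ps ≤ 3 * totalWorth c assignment
                      ⊎ length (side c) + G χ 𝒞 L (kept c bs) ≤ totalWorth c assignment + Slack c

    complete : ∀ c ps bs rest → map piece bs ++ rest ↭ ps → All (Placeable χ 𝒞 L) ps → total order ps ≤ n →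
               Unique (imagesOf bs) → Completed c ps bs
    complete c ps bs rest perm ok fits u = assemble (fill c U others ok-others uU fits-others)
      where
      keep drop : List (Block χ 𝒞)
      keep = kept c bs
      drop = kept (other c) bs

      U : List (Fin n)
      U = imagesOf keep

      -- Blocks of the other hue are dissolved: their pieces return to the pool and their vertices
      -- become free again.
      others : List (Piece n)
      others = map piece drop ++ rest

      split : others ++ map piece keep ↭ ps
      split = ↭-trans (++-comm others (map piece keep))
        (↭-trans (↭-reflexive (≡.trans (sym (++-assoc (map piece keep) (map piece drop) rest))
            (cong (_++ rest) (sym (map-++ piece keep drop)))))
          (↭-trans (++⁺ʳ rest (map⁺ piece (↭-sym (colour-partition-at hue c bs)))) perm))

      ok-others : All (Placeable χ 𝒞 L) others
      ok-others = All-++⁻ˡ others (All-resp-↭ (↭-sym split) ok)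

      uU : Unique U
      uU = proj₁ (Unique-++⁻ U (subst Unique (concatMap-++ proj₂ (map placed keep) (map placed drop))
        (subst (Unique ∘ images) (map-++ placed keep drop)
          (Unique-resp-↭ (concatMap-↭ proj₂ (map⁺ placed (colour-partition-at hue c bs))) u))))

      length-U : ∀ bs → length (imagesOf bs) ≡ total order (map piece bs)
      length-U []       = ≡.refl
      length-U (b ∷ bs) = ≡.trans (length-++ (image b)) (cong₂ _+_ (same-length b) (length-U bs))

      orders : total order others + total order (map piece keep) ≡ total order ps
      orders = ≡.trans (sym (total-++ order others (map piece keep))) (total-↭ order split)

      fits-others : total order others + length U ≤ n
      fits-others = ≤-trans (≤-reflexive (≡.trans (cong (total order others +_) (length-U keep)) orders)) fits

      assemble : ∃[ extra ] Extension U others extra ×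
                   (total order others ≤ totalWorth c extra ⊎ length
                       (fresh U (side c)) ≤ totalWorth c extra + Slack c) →
                 Completed c ps bs
      assemble (extra , (ps≡ , ux , same-x) , outcome) = record
        { assignment  = extra ++ map placed keep
        ; pieces      = ↭-trans (↭-reflexive (≡.trans (map-++ proj₁ extra (map placed keep))
                          (cong₂ _++_ ps≡ (sym (map-∘ keep))))) split
        ; disjoint-im = subst Unique (sym (concatMap-++ proj₂ extra (map placed keep))) ux
        ; same        = All-++⁺ same-x (All-map⁺ (All.tabulate λ {b} _ → same-length b))
        ; bound       = subst (λ w → 2 * total order ps ≤ 3 * w ⊎ length (side c) + G χ 𝒞 L keep ≤ w + Slack c)
                          (sym (total-++ _ extra (map placed keep)))
                          ([ inj₁ ∘ all-placed , inj₂ ∘ exhausted ]′ outcome)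
        }
        where
        w₁ w₂ g s : ℕ
        w₁ = totalWorth c extra
        w₂ = totalWorth c (map placed keep)
        g  = G χ 𝒞 L keep
        s  = used χ 𝒞 L c keep
        all-placed : total order others ≤ w₁ → 2 * total order ps ≤ 3 * (w₁ + w₂)
        all-placed h = begin
          2 * total order ps                                            ≡⟨ cong (2 *_) (sym orders) ⟩
          2 * (total order others + total order (map piece keep))       ≡⟨ *-distribˡ-+ 2
              (total order others) _ ⟩
          2 * total order others + 2 * total order (map piece keep)     ≤⟨ +-mono-≤ (*-mono-≤ (n≤1+n 2) h)
              (≤-trans (two-thirds c keep) (*-monoʳ-≤ 3 (kept-worth c bs))) ⟩
          3 * w₁ + 3 * w₂                                               ≡⟨ sym (*-distribˡ-+ 3 w₁ w₂) ⟩
          3 * (w₁ + w₂)                                                 ∎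
          where open ≤-Reasoning
        -- Kept blocks occupy at most s vertices of the side and are worth at least `g + s`, so g
        -- remains as surplus.
        exhausted : length (fresh U (side c)) ≤ w₁ + Slack c → length (side c) + g ≤ w₁ + w₂ + Slack c
        exhausted h = begin
          length (side c) + g                 ≤⟨ +-monoˡ-≤ g (≤-trans (length-fresh-within U (side c)
              (unique c)) (+-mono-≤ h (within-≤-used c keep))) ⟩
          w₁ + Slack c + s + g                ≡⟨ lem w₁ (Slack c) s g ⟩
          w₁ + (g + s) + Slack c              ≤⟨ +-monoˡ-≤ (Slack c) (+-monoʳ-≤ w₁ (kept-worth c bs)) ⟩
          w₁ + w₂ + Slack c                   ∎
          where
          open ≤-Reasoning
          lem : ∀ a b c d → a + b + c + d ≡ a + (d + c) + b
          lem = solve-∀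

-- Combining the two completions, and the choice of constants.

module Main where

  open import Data.Fin using (Fin)
  open import Data.List using (List; []; _∷_; _++_; length; map; concatMap)
  open import Data.List.Membership.Propositional using (_∈_)
  open import Data.List.Properties using (++-identityʳ; concatMap-map)
  open import Data.List.Relation.Binary.Permutation.Propositional using (_↭_; ↭-sym; ↭-trans; ↭-reflexive)
  open import Data.List.Relation.Binary.Permutation.Propositional.Properties using (∈-resp-↭; All-resp-↭)
  open import Data.List.Relation.Unary.All as All using (All; []; _∷_)
  open import Data.List.Relation.Unary.All.Properties using () renaming (map⁻ to All-map⁻)
  open import Data.List.Relation.Unary.AllPairs using ([]; _∷_)
  open import Data.List.Relation.Unary.Unique.Propositional using (Unique)
  open import Data.Nat
  open import Data.Nat.Properties
  open import Data.Nat.Tactic.RingSolver using (solve-∀)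
  open import Data.Product using (∃-syntax; Σ-syntax; _,_; proj₁)
  open import Data.Sum using (_⊎_; inj₁; inj₂; [_,_]′) renaming (map to map-⊎)
  open import Function using (_∘_)
  open import Relation.Binary.PropositionalEquality
  open import Defs
  open ListLemmas
  open Arcs
  open Cycles
  open Embedding
  open CliqueCover
  open Blocks
  open Completion

  -- n ≤ R + (A + B) is the clique cover, W the total waste, uA and uB the vertices of the two
  -- sides in blocks; A is the exhausted side.
  exhausted-gain : ∀ {n R A B W uA uB g} → n ≤ R + (A + B) → A ≤ W + uA → uA + uB ≤ 3 * g →
                   (B + uA ≤ suc (A + uB) ⊎ g ≡ uA) → n ≤ 3 * g + (2 * W + 1 + R) ⊎ A ≤ g + W
  exhausted-gain {W = W} {uA = uA} cover A≤ _ (inj₂ refl) = inj₂ (≤-trans A≤ (≤-reflexive (+-comm W uA)))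
  exhausted-gain {n} {R} {A} {B} {W} {uA} {uB} {g} cover A≤ thirds (inj₁ h) = inj₁ (begin
    n                          ≤⟨ cover ⟩
    R + (A + B)                ≤⟨ +-monoʳ-≤ R (+-mono-≤ A≤ B≤) ⟩
    R + (W + uA + (1 + W + uB)) ≡⟨ lem₁ R W uA uB ⟩
    uA + uB + (2 * W + 1 + R)  ≤⟨ +-monoˡ-≤ (2 * W + 1 + R) thirds ⟩
    3 * g + (2 * W + 1 + R)    ∎)
    where
    open ≤-Reasoning
    lem₁ : ∀ R W a b → R + (W + a + (1 + W + b)) ≡ a + b + (2 * W + 1 + R)
    lem₁ = solve-∀
    lem₂ : ∀ W a b → suc (W + a + b) ≡ 1 + W + b + a
    lem₂ = solve-∀
    -- The exhausted side has at most W vertices outside the blocks, so the other side has at most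
    -- one more than that.
    B≤ : B ≤ 1 + W + uB
    B≤ = +-cancelʳ-≤ uA _ _ (≤-trans h (≤-trans (s≤s (+-monoˡ-≤ uB A≤)) (≤-reflexive (lem₂ W uA uB))))

  -- The total loss in `some-colour`: 3W from each of the two completions, `3W + 1 + R` from the
  -- bound on the gain, and 3R from the cover.
  Error : ℕ → ℕ → ℕ
  Error W R = 9 * W + 4 * R + 1

  average : ∀ n x y E → 4 * n ≤ x + y + 2 * E → 2 * n ≤ x + E ⊎ 2 * n ≤ y + E
  average n x y E h = +-≤-split (m≤n⇒m≤1+n (subst₂ _≤_ (lem₁ n) (lem₂ x y E) h))
    where
    lem₁ : ∀ n → 4 * n ≡ 2 * n + 2 * n
    lem₁ = solve-∀
    lem₂ : ∀ x y E → x + y + 2 * E ≡ x + E + (y + E)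
    lem₂ = solve-∀

  -- Three of the four copies of n are paid by the sizes of the sides, the fourth by three times the
  -- total surplus. Their sum bounds `3 * vA + 3 * vB`, and one of the two colours reaches the
  -- average.
  some-colour : ∀ n R A B W gA gB vA vB → n ≤ R + (A + B) → A + gA ≤ vA + W → B + gB ≤ vB + W →
                n ≤ 3 * (gA + gB) + (3 * W + 1 + R) → 2 * n ≤ 3 * vA + Error W R ⊎ 2 * n ≤ 3 * vB + Error W R
  some-colour n R A B W gA gB vA vB cover hA hB gain = average n (3 * vA) (3 * vB) (Error W R) (begin
    4 * n                                                              ≡⟨ lem₁ n ⟩
    3 * n + n                                                          ≤⟨ +-mono-≤ (*-monoʳ-≤ 3 cover) gain ⟩
    3 * (R + (A + B)) + (3 * (gA + gB) + (3 * W + 1 + R))              ≡⟨ lem₂ R A B gA gB W ⟩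
    3 * (A + gA) + 3 * (B + gB) + (3 * W + 1 + 4 * R)                  ≤⟨ +-monoˡ-≤ (3 * W + 1 + 4 * R)
        (+-mono-≤ (*-monoʳ-≤ 3 hA) (*-monoʳ-≤ 3 hB)) ⟩
    3 * (vA + W) + 3 * (vB + W) + (3 * W + 1 + 4 * R)                  ≤⟨ m≤m+n _ (9 * W + 4 * R + 1) ⟩
    3 * (vA + W) + 3 * (vB + W) + (3 * W + 1 + 4 * R) + (9 * W + 4 * R + 1) ≡⟨ lem₃ vA vB W R ⟩
    3 * vA + 3 * vB + 2 * Error W R                                    ∎)
    where
    open ≤-Reasoning
    lem₁ : ∀ n → 4 * n ≡ 3 * n + n
    lem₁ = solve-∀
    lem₂ : ∀ R A B gA gB W → 3 * (R + (A + B)) + (3 * (gA + gB) + (3 * W + 1 + R)) ≡ 3 * (A + gA) + 3 *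
        (B + gB) + (3 * W + 1 + 4 * R)
    lem₂ = solve-∀
    lem₃ : ∀ vA vB W R → 3 * (vA + W) + 3 * (vB + W) + (3 * W + 1 + 4 * R) +
        (9 * W + 4 * R + 1) ≡ 3 * vA + 3 * vB + 2 * (9 * W + 4 * R + 1)
    lem₃ = solve-∀

  small-side : ∀ n R A B W gB vB → n ≤ R + (A + B) → 3 * A ≤ n → B + gB ≤ vB + W → 2 * n ≤ 3 * vB + Error W R
  small-side n R A B W gB vB cover small hB = +-cancelʳ-≤ n _ _ (begin
    2 * n + n                       ≡⟨ lem₁ n ⟩
    3 * n                           ≤⟨ *-monoʳ-≤ 3 cover ⟩
    3 * (R + (A + B))               ≡⟨ lem₂ R A B ⟩
    3 * A + 3 * B + 3 * R           ≤⟨ +-monoˡ-≤ (3 * R) (+-mono-≤ small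
        (*-monoʳ-≤ 3 (≤-trans (m≤m+n B gB) hB))) ⟩
    n + 3 * (vB + W) + 3 * R        ≤⟨ m≤m+n _ (6 * W + R + 1) ⟩
    n + 3 * (vB + W) + 3 * R + (6 * W + R + 1) ≡⟨ lem₃ n vB W R ⟩
    3 * vB + Error W R + n          ∎)
    where
    open ≤-Reasoning
    lem₁ : ∀ n → 2 * n + n ≡ 3 * n
    lem₁ = solve-∀
    lem₂ : ∀ R A B → 3 * (R + (A + B)) ≡ 3 * A + 3 * B + 3 * R
    lem₂ = solve-∀
    lem₃ : ∀ n v W R → n + 3 * (v + W) + 3 * R + (6 * W + R + 1) ≡ 3 * v + (9 * W + 4 * R + 1) + n
    lem₃ = solve-∀

  gain-from-side : ∀ n A g W R → A ≤ g + W → n ≤ 3 * A → n ≤ 3 * g + (3 * W + 1 + R)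
  gain-from-side n A g W R h n≤ = ≤-trans n≤ (≤-trans (*-monoʳ-≤ 3 h)
    (≤-trans (m≤m+n _ (1 + R)) (≤-reflexive (lem g W R))))
    where
    lem : ∀ g W R → 3 * (g + W) + (1 + R) ≡ 3 * g + (3 * W + 1 + R)
    lem = solve-∀

  Gain : ℕ → ℕ → ℕ → ℕ → ℕ → ℕ → Set
  Gain n R A B W g = n ≤ 3 * g + (2 * W + 1 + R) ⊎ A ≤ g + W ⊎ B ≤ g + W

  two-thirds-of-some-colour : ∀ {n R A B W gA gB vA vB} → n ≤ R + (A + B) → Gain n R A B W (gA + gB) →
    (2 * n ≤ 3 * vA ⊎ A + gA ≤ vA + W) → (2 * n ≤ 3 * vB ⊎ B + gB ≤ vB + W) →
    2 * n ≤ 3 * vA + Error W R ⊎ 2 * n ≤ 3 * vB + Error W R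
  two-thirds-of-some-colour cover gain (inj₁ h) _        = inj₁ (≤-trans h (m≤m+n _ _))
  two-thirds-of-some-colour cover gain (inj₂ _) (inj₁ h) = inj₂ (≤-trans h (m≤m+n _ _))
  two-thirds-of-some-colour {n} {R} {A} {B} {W} {gA} {gB} {vA} {vB} cover (inj₁ gain) (inj₂ hA) (inj₂ hB) =
    some-colour n R A B W gA gB vA vB cover hA hB
      (≤-trans gain (+-monoʳ-≤ (3 * (gA + gB)) (+-monoˡ-≤ R (+-monoˡ-≤ 1 (*-monoˡ-≤ W (n≤1+n 2))))))
  two-thirds-of-some-colour {n} {R} {A} {B} {W} {gA} {gB} {vA} {vB} cover (inj₂ (inj₁ gain)) (inj₂ hA)
      (inj₂ hB) with ≤-total n (3 * A)
  ... | inj₁ big   = some-colour n R A B W gA gB vA vB cover hA hB (gain-from-side n A (gA + gB) W R gain big)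
  ... | inj₂ small = inj₂ (small-side n R A B W gB vB cover small hB)
  two-thirds-of-some-colour {n} {R} {A} {B} {W} {gA} {gB} {vA} {vB} cover (inj₂ (inj₂ gain)) (inj₂ hA)
      (inj₂ hB) with ≤-total n (3 * B)
  ... | inj₁ big   = some-colour n R A B W gA gB vA vB cover hA hB (gain-from-side n B (gA + gB) W R gain big)
  ... | inj₂ small = inj₁ (small-side n R B A W gA vA (≤-trans cover
      (≤-reflexive (cong (R +_) (+-comm A B)))) small hA)

  -- 17 = 3 + 9 + 4 + 1 adds up the coefficients of the error terms.
  cancel-errors : ∀ {n v w O W R q} → 2 * n ≤ 3 * w + Error W R → w ≤ v + O →
    17 * q * W ≤ n → 17 * q * R ≤ n → 17 * q ≤ n → 17 * q * O ≤ n → 2 * (q * n) ≤ 3 * (q * v) + n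
  cancel-errors {n} {v} {w} {O} {W} {R} {q} bound w≤ W≤ R≤ 1≤ O≤ = *-cancelˡ-≤ 17 (begin
    17 * (2 * (q * n))                                       ≡⟨ lem₁ q n ⟩
    17 * q * (2 * n)                                         ≤⟨ *-monoʳ-≤ (17 * q) (≤-trans bound
        (+-monoˡ-≤ (Error W R) (*-monoʳ-≤ 3 w≤))) ⟩
    17 * q * (3 * (v + O) + (9 * W + 4 * R + 1))             ≡⟨ lem₂ (17 * q) v O W R ⟩
    3 * (17 * q * v) + (3 * (17 * q * O) + (9 * (17 * q * W) + 4 * (17 * q * R) + 17 * q))
      ≤⟨ +-monoʳ-≤ (3 * (17 * q * v)) (+-mono-≤ (*-monoʳ-≤ 3 O≤) (+-mono-≤ (+-mono-≤ (*-monoʳ-≤ 9 W≤)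
          (*-monoʳ-≤ 4 R≤)) 1≤)) ⟩
    3 * (17 * q * v) + (3 * n + (9 * n + 4 * n + n))         ≡⟨ lem₃ q v n ⟩
    17 * (3 * (q * v) + n)                                   ∎)
    where
    open ≤-Reasoning
    lem₁ : ∀ q n → 17 * (2 * (q * n)) ≡ 17 * q * (2 * n)
    lem₁ = solve-∀
    lem₂ : ∀ M v O W R → M * (3 * (v + O) + (9 * W + 4 * R + 1)) ≡ 3 * (M * v) + (3 * (M * O) +
        (9 * (M * W) + 4 * (M * R) + M))
    lem₂ = solve-∀
    lem₃ : ∀ q v n → 3 * (17 * q * v) + (3 * n + (9 * n + 4 * n + n)) ≡ 17 * (3 * (q * v) + n)
    lem₃ = solve-∀

  module Bound (d : ℕ) where

    private
      -- q is the denominator of δ. Every error has to be at most n / M with M = 17q, as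
      -- `cancel-errors` requires. Cutting into pieces of at most L = 2M vertices costs one edge per
      -- M vertices. A clique wastes at most T vertices, so it is given more than T * M. R bounds
      -- the uncovered vertices, and `n₀` makes R at most n / M.
      q M L T t R : ℕ
      q = suc d
      M = 17 * q
      L = M + M
      T = 2 ^ (L + L) * L
      t = T * M
      R = 2 ^ (suc t + suc t)

      3≤M : 3 ≤ M
      3≤M = ≤-trans (m≤m+n 3 14) (m≤m*n 17 q)

    n₀ : ℕ
    n₀ = M * R

    module _ {n} (n≥n₀ : n ≥ n₀) (F : Graph (Fin n)) (reg : TwoFactor F) (χ : EdgeColouring (K n)) where

      private
        M≤n : M ≤ n
        M≤n = ≤-trans (m≤m*n M R {{m^n≢0 2 (suc t + suc t)}}) n≥n₀

      module _ (ps : List (Piece n)) (u : Unique (concatMap verts ps)) (all-in : ∀ v → v ∈ concatMap verts ps)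
               (ok : All (IsPiece F M 3≤M) ps) (𝒞 : Cliques χ (suc t)) (cover : n ≤ R + covered χ 𝒞) where

        open Cliques 𝒞
        open Block

        private
          size-ps : total order ps ≡ n
          size-ps = trans (total-order ps) (covering-length u all-in)

          placeable : All (Placeable χ 𝒞 L) ps
          placeable = All.map (λ (long , short , _) → long , short) ok

          W : ℕ
          W = length (cliques red) * T + length (cliques blue) * T

          slack≤W : ∀ c → length (cliques c) * T ≤ W
          slack≤W red  = m≤m+n _ _
          slack≤W blue = m≤n+m _ (length (cliques red) * T)

          M*slack : ∀ c → M * (length (cliques c) * T) ≤ length (side c)
          M*slack c = begin
            M * (length (cliques c) * T)  ≡⟨ lem M (length (cliques c)) T ⟩
            length (cliques c) * t        ≤⟨ *-monoʳ-≤ (length (cliques c)) (n≤1+n t) ⟩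
            length (cliques c) * suc t    ≡⟨ sym (length-concat χ (cliques c) (size c)) ⟩
            length (side c)               ∎
            where
            open ≤-Reasoning
            lem : ∀ M k T → M * (k * T) ≡ k * (T * M)
            lem = solve-∀

          M*W : M * W ≤ n
          M*W = ≤-trans (≤-reflexive (*-distribˡ-+ M (length (cliques red) * T) _))
            (≤-trans (+-mono-≤ (M*slack red) (M*slack blue)) (covered-≤ χ 𝒞))

          M*open : M * total openness ps ≤ n
          M*open = ≤-trans (≤-reflexive (sym (total-* M openness ps))) (≤-trans
            (total-≤ (λ p → M * openness p) order (All.map (λ {p} (_ , _ , open≤ , _) → ≤-trans
                (≤-reflexive (*-comm M (openness p))) open≤) ok))
            (≤-reflexive size-ps))

          block-size : ∀ bs → used χ 𝒞 L red bs + used χ 𝒞 L blue bs ≡ total order (map piece bs)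
          block-size bs = trans (sym (total-+ (λ b → share b red) (λ b → share b blue) bs)) (go bs)
            where
            go : ∀ bs → total (λ b → share b red + share b blue) bs ≡ total order (map piece bs)
            go []       = refl
            go (b ∷ bs) = cong₂ _+_ (shares b) (go bs)

          block-thirds : ∀ bs → total order (map piece bs) ≤ 3 * G χ 𝒞 L bs
          block-thirds bs = ≤-trans (≤-reflexive (total-map order piece bs))
            (≤-trans (total-≤ (order ∘ piece) (λ b → 3 * half b) {bs} (All.tabulate λ {b} _ → third≤half b))
                (≤-reflexive (total-* 3 half bs)))

          exhausted-side : ∀ c bs → Exhausted χ 𝒞 L c bs → length (side c) ≤ W + used χ 𝒞 L c bs
          exhausted-side c bs ex = ≤-trans (length-fresh-within (imagesOf χ 𝒞 L bs) (side c) (unique c))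
            (+-mono-≤ (≤-trans ex (slack≤W c)) (within-≤-used χ 𝒞 L c bs))

          gain : ∀ bs rest → map piece bs ++ rest ↭ ps → (∀ c → Balanced χ 𝒞 L c bs) →
                 rest ≡ [] ⊎ ∃[ c ] Exhausted χ 𝒞 L c bs →
                 Gain n R (length (side red)) (length (side blue)) W (G χ 𝒞 L bs)
          gain bs rest perm bal (inj₁ refl) = inj₁ (≤-trans
            (≤-trans (≤-reflexive (trans (sym size-ps) (trans (sym (total-↭ order perm)) (cong (total order)
                (++-identityʳ (map piece bs))))))
              (block-thirds bs)) (m≤m+n _ _))
          -- Exhaustion of one side is paired with the balance of the opposite colour, which says
          -- how many vertices the opposite side can still have left.
          gain bs rest perm bal (inj₂ (red , ex)) = map-⊎ (λ h → h) inj₁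
            (exhausted-gain cover (exhausted-side red bs ex) (≤-trans (≤-reflexive (block-size bs))
                (block-thirds bs)) (bal blue))
          gain bs rest perm bal (inj₂ (blue , ex)) = map-⊎ (λ h → h) inj₂
            (exhausted-gain (≤-trans cover (≤-reflexive (cong (R +_) (+-comm (length (side red)) _))))
                (exhausted-side blue bs ex)
              (≤-trans (≤-reflexive (trans (+-comm (used χ 𝒞 L blue bs) _) (block-size bs)))
                  (block-thirds bs)) (bal red))

          -- The worth includes one credit per open piece. Passing to true edges therefore costs
          -- `total openness ps`, the term O of `cancel-errors`.
          good-copy : ∀ c bs → (κ : Completed χ 𝒞 L c ps bs) →
                      2 * n ≤ 3 * totalWorth χ 𝒞 L c (Completed.assignment κ) + Error W R →
                      Σ[ H ∈ Copy F (K n) ] Σ[ c ∈ Colour ] 2 * (q * n) ≤ 3 * (q * #edgesOfColour χ c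
                          (subgraph H)) + n
          good-copy c bs κ bound = copyOf χ F asg su sa disjoint-im same long edges , c ,
            cancel-errors {w = totalWorth χ 𝒞 L c asg} {O = total openness ps} {W = W} {R = R} {q = q} bound worth≤ M*W n≥n₀ M≤n M*open
            where
            open Completed κ using (pieces; disjoint-im; same) renaming (assignment to asg)
            sources-↭ : sources asg ↭ concatMap verts ps
            sources-↭ = ↭-trans (↭-reflexive (sym (concatMap-map verts proj₁ asg))) (concatMap-↭ verts pieces)
            su : Unique (sources asg)
            su = Unique-resp-↭ (↭-sym sources-↭) u
            sa : ∀ v → v ∈ sources asg
            sa v = ∈-resp-↭ (↭-sym sources-↭) (all-in v)
            ok-asg : All (λ (p , _) → IsPiece F M 3≤M p) asg
            ok-asg = All-map⁻ (All-resp-↭ (↭-sym pieces) ok)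
            long : All (λ (p , _) → 3 ≤ length (verts p)) asg
            long = All.map proj₁ ok-asg
            edges : All (λ ((b , xs) , _) → EdgesOf F (arcs b xs)) asg
            edges = All.map (λ (_ , _ , _ , es) → es) ok-asg
            worth≤ : totalWorth χ 𝒞 L c asg ≤ #edgesOfColour χ c
                (subgraph (copyOf χ F asg su sa disjoint-im same long edges)) + total openness ps
            worth≤ = ≤-trans (≤-reflexive (totalWorth-count χ 𝒞 L c asg))
              (+-mono-≤ (count-≤-edges χ F asg su sa disjoint-im same long edges c)
                  (≤-reflexive (total-↭ openness pieces)))

          module _ (bs : List (Block χ 𝒞)) (rest : List (Piece n)) (perm : map piece bs ++ rest ↭ ps)
                   (ub : Unique (images (map placed bs))) (bal : ∀ c → Balanced χ 𝒞 L c bs)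
                   (outcome : rest ≡ [] ⊎ ∃[ c ] Exhausted χ 𝒞 L c bs) where

            G-split : G χ 𝒞 L bs ≡ G χ 𝒞 L (kept χ 𝒞 L red bs) + G χ 𝒞 L (kept χ 𝒞 L blue bs)
            G-split = trans (total-↭ half (colour-partition hue bs)) (total-++ half (kept χ 𝒞 L red bs) _)

            κ : ∀ c → Completed χ 𝒞 L c ps bs
            κ c = complete χ 𝒞 L c ps bs rest perm placeable (≤-reflexive size-ps) ub

            w : Colour → ℕ
            w c = totalWorth χ 𝒞 L c (Completed.assignment (κ c))

            bound : ∀ c → 2 * n ≤ 3 * w c ⊎ length (side c) + G χ 𝒞 L (kept χ 𝒞 L c bs) ≤ w c + W
            bound c = map-⊎ (subst (λ k → 2 * k ≤ 3 * w c) size-ps) (λ h → ≤-trans h (+-monoʳ-≤ (w c)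
                (slack≤W c)))
                        (Completed.bound (κ c))

            copy-from-blocks : Σ[ H ∈ Copy F (K n) ] Σ[ c ∈ Colour ] 2 * (q * n) ≤ 3 *
                (q * #edgesOfColour χ c (subgraph H)) + n
            copy-from-blocks = [ good-copy red bs (κ red) , good-copy blue bs (κ blue) ]′
              (two-thirds-of-some-colour {vA = w red} {vB = w blue} cover
                (subst (Gain n R (length (side red)) (length (side blue)) W) G-split
                    (gain bs rest perm bal outcome))
                (bound red) (bound blue))

        copy-from-cover : Σ[ H ∈ Copy F (K n) ] Σ[ c ∈ Colour ] 2 * (q * n) ≤ 3 * (q * #edgesOfColour χ c
            (subgraph H)) + n
        copy-from-cover
          -- Without blocks the second alternative of `Balanced` holds for both colours, as 0 = 0.
          with bs , rest , perm , ub , bal , outcome ← build-blocks χ 𝒞 L ps [] placeable [] (λ _ → inj₂ refl) =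
          copy-from-blocks bs rest perm ub bal outcome

      -- Divided by 3q, the inequality gives at least (2/3 - 1/(3q)) n edges of colour c.
      copy-with-many-edges : Σ[ H ∈ Copy F (K n) ] Σ[ c ∈ Colour ] 2 * (q * n) ≤ 3 * (q * #edgesOfColour χ c
          (subgraph H)) + n
      copy-with-many-edges with ps , u , all-in , ok ← piece-decomposition F M 3≤M reg | 𝒞 , cover ← clique-cover χ t =
        copy-from-cover ps u all-in ok 𝒞 cover

-- From the integer inequality to the rational δ.

module RationalBound where

  open import Data.Integer as ℤ using (ℤ; +_; +[1+_]; -[1+_])
  import Data.Integer.Properties as ℤ
  open import Data.Integer.Tactic.RingSolver using (solve-∀)
  open import Data.Nat as ℕ using (ℕ; zero; suc)
  import Data.Nat.Properties as ℕ
  open import Data.Product using (∃-syntax; _,_)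
  open import Data.Rational
  open import Data.Rational.Properties
  import Data.Rational.Unnormalised as ℚᵘ
  import Data.Rational.Unnormalised.Properties as ℚᵘ
  open import Relation.Binary.PropositionalEquality
  open import Defs using (fromℕ)

  toℚᵘ-fromℕ : ∀ k → toℚᵘ (fromℕ k) ℚᵘ.≃ ℚᵘ.mkℚᵘ (+ k) 0
  toℚᵘ-fromℕ k = toℚᵘ-fromℚᵘ (ℚᵘ.mkℚᵘ (+ k) 0)

  module _ (p d n v : ℕ) (h : 2 ℕ.* (suc d ℕ.* n) ℕ.≤ 3 ℕ.* (suc d ℕ.* v) ℕ.+ n) where

    -- The claim with its denominators cleared. The extra n on the right of `h` is absorbed by the
    -- term with δ, because `3 * suc p` is at least 1.
    integer-bound : (+ 2 ℤ.* + suc d ℤ.+ (ℤ.- + suc p) ℤ.* + 3) ℤ.* + n ℤ.≤ + v ℤ.* (+ 3 ℤ.* + suc d)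
    integer-bound = begin
      (+ 2 ℤ.* + suc d ℤ.+ (ℤ.- + suc p) ℤ.* + 3) ℤ.* + n               ≡⟨ lem₁ (+ suc d) (+ suc p) (+ n) ⟩
      + 2 ℤ.* (+ suc d ℤ.* + n) ℤ.- + 3 ℤ.* (+ suc p ℤ.* + n)           ≤⟨ ℤ.+-mono-≤ h′ (ℤ.neg-mono-≤ n≤) ⟩
      + 3 ℤ.* (+ suc d ℤ.* + v) ℤ.+ + n ℤ.- + n                         ≡⟨ lem₂ (+ suc d) (+ v) (+ n) ⟩
      + v ℤ.* (+ 3 ℤ.* + suc d)                                         ∎
      where
      open ℤ.≤-Reasoning
      lem₁ : ∀ q p n → (+ 2 ℤ.* q ℤ.+ (ℤ.- p) ℤ.* + 3) ℤ.* n ≡ + 2 ℤ.* (q ℤ.* n) ℤ.- + 3 ℤ.* (p ℤ.* n)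
      lem₁ = solve-∀
      lem₂ : ∀ q v n → + 3 ℤ.* (q ℤ.* v) ℤ.+ n ℤ.- n ≡ v ℤ.* (+ 3 ℤ.* q)
      lem₂ = solve-∀
      pos-*³ : ∀ a b c → + (a ℕ.* (b ℕ.* c)) ≡ + a ℤ.* (+ b ℤ.* + c)
      pos-*³ a b c = trans (ℤ.pos-* a (b ℕ.* c)) (cong (+ a ℤ.*_) (ℤ.pos-* b c))
      h′ : + 2 ℤ.* (+ suc d ℤ.* + n) ℤ.≤ + 3 ℤ.* (+ suc d ℤ.* + v) ℤ.+ + n
      h′ = subst₂ ℤ._≤_ (pos-*³ 2 (suc d) n)
        (trans (ℤ.pos-+ (3 ℕ.* (suc d ℕ.* v)) n) (cong (ℤ._+ + n) (pos-*³ 3 (suc d) v))) (ℤ.+≤+ h)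
      n≤ : + n ℤ.≤ + 3 ℤ.* (+ suc p ℤ.* + n)
      n≤ = subst (+ n ℤ.≤_) (pos-*³ 3 (suc p) n) (ℤ.+≤+ (ℕ.≤-trans (ℕ.m≤n*m n (suc p))
          (ℕ.m≤n*m (suc p ℕ.* n) 3)))

    unnormalised-bound : (ℚᵘ.mkℚᵘ (+ 2) 2 ℚᵘ.- ℚᵘ.mkℚᵘ +[1+ p ] d) ℚᵘ.* ℚᵘ.mkℚᵘ (+ n) 0 ℚᵘ.≤ ℚᵘ.mkℚᵘ (+ v) 0
    unnormalised-bound = ℚᵘ.*≤* (subst₂ ℤ._≤_ (sym (ℤ.*-identityʳ _))
      (cong (+ v ℤ.*_) (trans (sym (ℤ.pos-* 3 (suc d)))
          (cong +_ (sym (ℕ.*-identityʳ (3 ℕ.* suc d)))))) integer-bound)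

  -- A positive δ with denominator `suc d` is at least 1 / (d + 1), so it exceeds the loss 1 / (3 (d
  -- + 1)); the denominator is all that the combinatorial part has to know about δ.
  rational-bound : ∀ (δ : ℚ) → δ > 0ℚ → ∃[ d ] ∀ n v →
    2 ℕ.* (suc d ℕ.* n) ℕ.≤ 3 ℕ.* (suc d ℕ.* v) ℕ.+ n → ((+ 2 / 3) - δ) * fromℕ n ≤ fromℕ v
  rational-bound δ@(mkℚ +[1+ p ] d _) _ = d , λ n v h → toℚᵘ-cancel-≤ (begin
    toℚᵘ (((+ 2 / 3) - δ) * fromℕ n)                                             ≃⟨ toℚᵘ-homo-*
        ((+ 2 / 3) - δ) (fromℕ n) ⟩
    toℚᵘ ((+ 2 / 3) - δ) ℚᵘ.* toℚᵘ (fromℕ n)                                     ≃⟨ ℚᵘ.*-cong (difference δ)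
        (toℚᵘ-fromℕ n) ⟩
    (ℚᵘ.mkℚᵘ (+ 2) 2 ℚᵘ.- toℚᵘ δ) ℚᵘ.* ℚᵘ.mkℚᵘ
        (+ n) 0                           ≤⟨ unnormalised-bound p d n v h ⟩
    ℚᵘ.mkℚᵘ (+ v) 0                                                              ≃⟨ ℚᵘ.≃-sym (toℚᵘ-fromℕ v) ⟩
    toℚᵘ (fromℕ v)                                                               ∎)
    where
    open ℚᵘ.≤-Reasoning
    difference : ∀ δ → toℚᵘ ((+ 2 / 3) - δ) ℚᵘ.≃ ℚᵘ.mkℚᵘ (+ 2) 2 ℚᵘ.- toℚᵘ δ
    difference δ = ℚᵘ.≃-trans (toℚᵘ-homo-+ (+ 2 / 3) (- δ)) (ℚᵘ.+-congʳ (ℚᵘ.mkℚᵘ (+ 2) 2) (toℚᵘ-homo‿- δ))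
  rational-bound (mkℚ (+ zero) d _) (*<* (ℤ.+<+ ()))
  rational-bound (mkℚ -[1+ p ] d _) (*<* ())

open import Data.Fin using (Fin)
open import Data.Integer using (+_)
open import Data.Nat using (ℕ; _≥_)
open import Data.Product using (Σ-syntax; ∃-syntax; _,_)
open import Data.Rational using (ℚ; 0ℚ; _/_; _-_; _*_; _≤_; _>_)
open import Defs
open Main using (module Bound)
open RationalBound using (rational-bound)

theorem1p5 : ∀ (δ : ℚ) → δ > 0ℚ →
    ∃[ n₀ ] ∀ (n : ℕ) → n ≥ n₀ →
    ∀ (F : Graph (Fin n)) → TwoFactor F →
    ∀ (χ : EdgeColouring (K n)) →
    Σ[ H ∈ Copy F (K n) ] Σ[ c ∈ Colour ]
    ((+ 2 / 3) - δ) * fromℕ n ≤ fromℕ (#edgesOfColour χ c (subgraph H))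
theorem1p5 δ δ>0 =
  let d , bound = rational-bound δ δ>0
  in Bound.n₀ d , λ n n≥n₀ F reg χ →
     let H , c , many = Bound.copy-with-many-edges d n≥n₀ F reg χ
     in H , c , bound n (#edgesOfColour χ c (subgraph H)) many
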